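{- Let $A_1=(1,0,-1)^8\in\mathbb{Z}^{24}$ and $A_2=(0,1,-1,-1,3,-2,-2,5,-3,-3,7,-4,-4,9,-5,-5,11,-6,-6,13,-7,-7,15,-8)\in\mathbb{Z}^{24}$. Let $a_1,a_2$ be integers, $A=a_1A_1+a_2A_2$, and let $m$ be an odd positive integer such that $\gcd(a_1,a_2,m)=1$ and $\gcd(a_2,m)\in\{1,3\}$. Let $S=\mathrm{IAP}(\pi_m(A),\pi_m(A)X_{24})$. Then for every non-negative integer $\lambda$, the triangle $\nabla\big(S[3\lambda m]\big)$ is balanced in $\mathbb{Z}/m\mathbb{Z}$.
   Context: $\pi_m$ is reduction modulo $m$. $X_{24}$ is the $24\times24$ integer matrix with entries $\delta_{r,s}+\delta_{r,25-s}$, $r,s\in\{1,\dots,24\}$; tuples are row vectors. For $k$-tuples $A=(a_0,\dots,a_{k-1})$, $D=(d_0,\dots,d_{k-1})$, $\mathrm{IAP}(A,D)$ is the doubly infinite sequence $(u_j)_{j\in\mathbb{Z}}$ with $u_{qk+r}=a_r+qd_r$. For a sequence $S=(u_j)$, $S[n]$ denotes the $n$-tuple $(u_0,\dots,u_{n-1})$. For a finite tuple $(u_0,\dots,u_{n-1})$, the triangle $\nabla(u_0,\dots,u_{n-1})$ is the family $(a_{i,j})_{i,j\ge0,\,i+j<n}$ with $a_{0,j}=u_j$ and $a_{i,j}=-a_{i-1,j}-a_{i-1,j+1}$ for $i\ge1$, viewed as a multiset; it is balanced if all elements of $\mathbb{Z}/m\mathbb{Z}$ occur with the same multiplicity. 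-}

module Defs where

open import Data.Nat as ℕ using (ℕ; zero; suc; NonZero; _∸_)
open import Data.Nat.DivMod as ND using ()
open import Data.Integer as ℤ using (ℤ; +_; -_; _+_; _*_; _-_)
open import Data.Integer.DivMod using (_%ℕ_)
open import Data.Fin as Fin using (Fin; toℕ)
open import Data.Vec as Vec using (Vec; _∷_; [])
open import Data.List as List using (List; upTo; allFin; filter; length; concatMap; map; foldr)
open import Data.Product using (_×_; _,_)
open import Relation.Binary.PropositionalEquality using (_≡_)
open import Relation.Nullary using (does)
open import Data.Bool using (if_then_else_)

Tuple : ℕ → Set
Tuple k = Fin k → ℤ

infixl 7 _·_
infixl 6 _⊕_

_·_ : ∀ {k} → ℤ → Tuple k → Tuple k
(c · v) i = c * v i

_⊕_ : ∀ {k} → Tuple k → Tuple k → Tuple k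
(u ⊕ v) i = u i + v i

π : (m : ℕ) → .{{NonZero m}} → ℤ → ℤ
π m x = + (x %ℕ m)

πv : ∀ {k} (m : ℕ) → .{{NonZero m}} → Tuple k → Tuple k
πv m v i = π m (v i)

A₁ : Tuple 24
A₁ = Vec.lookup
  (+ 1 ∷ + 0 ∷ - + 1 ∷ + 1 ∷ + 0 ∷ - + 1 ∷ + 1 ∷ + 0 ∷ - + 1 ∷ + 1 ∷ + 0 ∷ - + 1 ∷
   + 1 ∷ + 0 ∷ - + 1 ∷ + 1 ∷ + 0 ∷ - + 1 ∷ + 1 ∷ + 0 ∷ - + 1 ∷ + 1 ∷ + 0 ∷ - + 1 ∷ [])

A₂ : Tuple 24
A₂ = Vec.lookup
  (+ 0 ∷ + 1 ∷ - + 1 ∷ - + 1 ∷ + 3 ∷ - + 2 ∷ - + 2 ∷ + 5 ∷ - + 3 ∷ - + 3 ∷ + 7 ∷ - + 4 ∷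
   - + 4 ∷ + 9 ∷ - + 5 ∷ - + 5 ∷ + 11 ∷ - + 6 ∷ - + 6 ∷ + 13 ∷ - + 7 ∷ - + 7 ∷ + 15 ∷ - + 8 ∷ [])

-- X₂₄ with entries δ_{r,s} + δ_{r,25-s} (1-based r,s); with 0-based indices
-- r' = r-1, s' = s-1 the second delta is r' + s' = 23.
δ : ℕ → ℕ → ℤ
δ a b = if does (a ℕ.≟ b) then + 1 else + 0

X₂₄ : Fin 24 → Fin 24 → ℤ
X₂₄ r s = δ (toℕ r) (toℕ s) + δ (toℕ r ℕ.+ toℕ s) 23

_⋆_ : ∀ {k} → Tuple k → (Fin k → Fin k → ℤ) → Tuple k
(v ⋆ M) s = foldr _+_ (+ 0) (map (λ r → v r * M r s) (allFin _))

-- IAP(A,D), restricted to non-negative indices j (only these are used by S[n]):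
-- u_{qk+r} = a_r + q d_r
IAP : ∀ {k} .{{_ : NonZero k}} → Tuple k → Tuple k → ℕ → ℤ
IAP {k} A D j = A (j ND.mod k) + (+ (j ND./ k)) * D (j ND.mod k)

-- triangle entries a_{i,j} built from a sequence u (a_{0,j} = u_j,
-- a_{i,j} = -a_{i-1,j} - a_{i-1,j+1}); for i + j < n they depend only on u_0..u_{n-1}
tri : (ℕ → ℤ) → ℕ → ℕ → ℤ
tri u zero    j = u j
tri u (suc i) j = - tri u i j - tri u i (suc j)

indices : ℕ → List (ℕ × ℕ)
indices n = concatMap (λ i → map (λ j → i , j) (upTo (n ∸ i))) (upTo n)

mult : (m : ℕ) → .{{NonZero m}} → (ℕ → ℤ) → ℕ → Fin m → ℕ
mult m u n r = length (filter (λ p → ((tri u (Data.Product.proj₁ p) (Data.Product.proj₂ p)) %ℕ m) ℕ.≟ toℕ r) (indices n))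
  where import Data.Product

Balanced : (m : ℕ) → .{{NonZero m}} → (ℕ → ℤ) → ℕ → Set
Balanced m u n = ∀ (r s : Fin m) → mult m u n r ≡ mult m u n s

-- The triangle of S is computed in closed form. Modulo m it agrees with Φ(i, j) = a₁ g(j - i) + a₂ H(i, j),
-- where g is the period-3 pattern of A₁ and H is, on each class of (i, j) modulo 3, affine in (⌊i/3⌋, ⌊j/3⌋):
-- Φ obeys the rule of ∇, and its row 0 agrees with S because the IAP difference A X₂₄ is exactly the drift of Φ
-- over 24 columns. Along every row, column and antidiagonal, Φ therefore interleaves three arithmetic
-- progressions whose differences are a₂ times ±1 or ±2, which are units modulo the odd m. If a₂ is a unit,
-- every residue occurs three times among 3m consecutive entries of a line; if gcd(a₂, m) = 3, the a₁-terms,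
-- which run through all classes modulo 3 since 3 ∤ a₁, give the same count. A count shared by all rows,
-- columns and antidiagonals of the triangle's side length is shared by all translates of the triangle, and
-- averaging over a 3m × 3m window of translates shows that it does not depend on the residue.
module Submission where

module FiniteSums where

  open import Data.Nat
  open import Data.Nat.Properties
  open import Data.Nat.Tactic.RingSolver using (solve-∀)
  open import Data.List using (List; []; _++_; [_]; length; filter; map; concatMap; upTo)
  open import Data.List.Properties using (length-++; filter-++; map-++; concatMap-++; upTo-∷ʳ; ++-identityʳ)
  open import Data.Product using (_×_; _,_)
  open import Relation.Binary.PropositionalEquality hiding ([_])
  open import Data.Bool using (true; false; if_then_else_)
  open import Relation.Nullary using (Dec; does; yes; no; ¬_)
  open import Relation.Nullary.Decidable using (dec-true; dec-false; does-⇔)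
  open import Function using (_∘_; _⇔_)
  open import Relation.Unary using (Pred; Decidable)
  open ≡-Reasoning
  open import Defs using (indices)

  ∑ : ℕ → (ℕ → ℕ) → ℕ
  ∑ zero    f = 0
  ∑ (suc n) f = ∑ n f + f n

  ⟦_⟧ : ∀ {p} {P : Set p} → Dec P → ℕ
  ⟦ P? ⟧ = if does P? then 1 else 0

  ⟦yes⟧ : ∀ {p} {P : Set p} (P? : Dec P) → P → ⟦ P? ⟧ ≡ 1
  ⟦yes⟧ P? p = cong (if_then 1 else 0) (dec-true P? p)

  ⟦no⟧ : ∀ {p} {P : Set p} (P? : Dec P) → ¬ P → ⟦ P? ⟧ ≡ 0
  ⟦no⟧ P? ¬p = cong (if_then 1 else 0) (dec-false P? ¬p)

  ⟦⟧-cong : ∀ {p q} {P : Set p} {Q : Set q} (P? : Dec P) (Q? : Dec Q) → P ⇔ Q → ⟦ P? ⟧ ≡ ⟦ Q? ⟧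
  ⟦⟧-cong P? Q? P⇔Q = cong (if_then 1 else 0) (does-⇔ P⇔Q P? Q?)

  ∑-cong : ∀ n {f g} → (∀ x → x < n → f x ≡ g x) → ∑ n f ≡ ∑ n g
  ∑-cong zero    _   = refl
  ∑-cong (suc n) f≡g = cong₂ _+_ (∑-cong n (λ x x<n → f≡g x (m<n⇒m<1+n x<n))) (f≡g n ≤-refl)

  ∑-cong-≗ : ∀ n {f g} → (∀ x → f x ≡ g x) → ∑ n f ≡ ∑ n g
  ∑-cong-≗ n f≗g = ∑-cong n (λ x _ → f≗g x)

  ∑-+ : ∀ n f g → ∑ n (λ x → f x + g x) ≡ ∑ n f + ∑ n g
  ∑-+ zero    f g = refl
  ∑-+ (suc n) f g = begin
    ∑ n (λ x → f x + g x) + (f n + g n) ≡⟨ cong (_+ (f n + g n)) (∑-+ n f g) ⟩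
    ∑ n f + ∑ n g + (f n + g n)         ≡⟨ +-shuffle (∑ n f) (∑ n g) (f n) (g n) ⟩
    ∑ n f + f n + (∑ n g + g n)         ∎
    where
    +-shuffle : ∀ a b c d → a + b + (c + d) ≡ a + c + (b + d)
    +-shuffle = solve-∀

  ∑-*ˡ : ∀ c n f → ∑ n (λ x → c * f x) ≡ c * ∑ n f
  ∑-*ˡ c zero    f = sym (*-zeroʳ c)
  ∑-*ˡ c (suc n) f = trans (cong (_+ c * f n) (∑-*ˡ c n f)) (sym (*-distribˡ-+ c (∑ n f) (f n)))

  ∑-+-split : ∀ a b f → ∑ (a + b) f ≡ ∑ a f + ∑ b (λ x → f (a + x))
  ∑-+-split a zero    f = trans (cong (λ n → ∑ n f) (+-identityʳ a)) (sym (+-identityʳ _))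
  ∑-+-split a (suc b) f = begin
    ∑ (a + suc b) f                                ≡⟨ cong (λ n → ∑ n f) (+-suc a b) ⟩
    ∑ (a + b) f + f (a + b)                        ≡⟨ cong (_+ f (a + b)) (∑-+-split a b f) ⟩
    ∑ a f + ∑ b (λ x → f (a + x)) + f (a + b)      ≡⟨ +-assoc (∑ a f) _ _ ⟩
    ∑ a f + ∑ (suc b) (λ x → f (a + x))            ∎

  ∑-head : ∀ n f → ∑ (suc n) f ≡ f 0 + ∑ n (λ x → f (suc x))
  ∑-head n f = ∑-+-split 1 n f

  ∑-const : ∀ n c → ∑ n (λ _ → c) ≡ n * c
  ∑-const zero    c = refl
  ∑-const (suc n) c = trans (cong (_+ c) (∑-const n c)) (+-comm (n * c) c)

  ∑-zero : ∀ n → ∑ n (λ _ → 0) ≡ 0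
  ∑-zero n = trans (∑-const n 0) (*-zeroʳ n)

  ∑-swap : ∀ a b (f : ℕ → ℕ → ℕ) → ∑ a (λ x → ∑ b (f x)) ≡ ∑ b (λ y → ∑ a (λ x → f x y))
  ∑-swap zero    b f = sym (∑-zero b)
  ∑-swap (suc a) b f = begin
    ∑ a (λ x → ∑ b (f x)) + ∑ b (f a)                 ≡⟨ cong (_+ ∑ b (f a)) (∑-swap a b f) ⟩
    ∑ b (λ y → ∑ a (λ x → f x y)) + ∑ b (f a)         ≡⟨ ∑-+ b (λ y → ∑ a (λ x → f x y)) (f a) ⟨
    ∑ b (λ y → ∑ (suc a) (λ x → f x y))               ∎

  ∑-periodic : ∀ m f → (∀ x → f (m + x) ≡ f x) → ∀ l → ∑ (l * m) f ≡ l * ∑ m f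
  ∑-periodic m f periodic zero    = refl
  ∑-periodic m f periodic (suc l) = begin
    ∑ (m + l * m) f                          ≡⟨ ∑-+-split m (l * m) f ⟩
    ∑ m f + ∑ (l * m) (λ x → f (m + x))      ≡⟨ cong (∑ m f +_) (∑-cong-≗ (l * m) periodic) ⟩
    ∑ m f + ∑ (l * m) f                      ≡⟨ cong (∑ m f +_) (∑-periodic m f periodic l) ⟩
    ∑ m f + l * ∑ m f                        ∎

  ∑-residues : ∀ N k f → ∑ (N * k) f ≡ ∑ k (λ c → ∑ N (λ q → f (c + q * k)))
  ∑-residues zero    k f = sym (∑-zero k)
  ∑-residues (suc N) k f = begin
    ∑ (k + N * k) f                                                      ≡⟨ ∑-+-split k (N * k) f ⟩
    ∑ k f + ∑ (N * k) (λ x → f (k + x))                                  ≡⟨ cong (∑ k f +_) (∑-residues N k (λ x → f (k + x))) ⟩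
    ∑ k f + ∑ k (λ c → ∑ N (λ q → f (k + (c + q * k))))                  ≡⟨ ∑-+ k f (λ c → ∑ N (λ q → f (k + (c + q * k)))) ⟨
    ∑ k (λ c → f c + ∑ N (λ q → f (k + (c + q * k))))                    ≡⟨ ∑-cong-≗ k (λ c → cong₂ _+_ (cong f (sym (+-identityʳ c))) (∑-cong-≗ N (λ q → cong f (shift c q)))) ⟩
    ∑ k (λ c → f (c + 0 * k) + ∑ N (λ q → f (c + suc q * k)))            ≡⟨ ∑-cong-≗ k (λ c → ∑-head N (λ q → f (c + q * k))) ⟨
    ∑ k (λ c → ∑ (suc N) (λ q → f (c + q * k)))                          ∎
    where
    shift : ∀ c q → k + (c + q * k) ≡ c + suc q * k
    shift c q = +-shift k c q
      where
      +-shift : ∀ k c q → k + (c + q * k) ≡ c + (k + q * k)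
      +-shift = solve-∀

  ∑-⟦≡⟧ : ∀ n {k₀} → k₀ < n → ∑ n (λ k → ⟦ k ≟ k₀ ⟧) ≡ 1
  ∑-⟦≡⟧ (suc n) {k₀} k₀<1+n with k₀ ≟ n
  ... | yes refl = begin
    ∑ n (λ k → ⟦ k ≟ n ⟧) + ⟦ n ≟ n ⟧   ≡⟨ cong₂ _+_ (∑-cong n (λ k k<n → ⟦no⟧ (k ≟ n) (<⇒≢ k<n))) (⟦yes⟧ (n ≟ n) refl) ⟩
    ∑ n (λ _ → 0) + 1                  ≡⟨ cong (_+ 1) (∑-zero n) ⟩
    1                                  ∎
  ... | no k₀≢n = cong₂ _+_ (∑-⟦≡⟧ n (≤∧≢⇒< (≤-pred k₀<1+n) k₀≢n)) (⟦no⟧ (n ≟ k₀) (k₀≢n ∘ sym))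

  ∑△ : ℕ → (ℕ → ℕ → ℕ) → ℕ
  ∑△ n f = ∑ n (λ i → ∑ (n ∸ i) (f i))

  ∑△-cong-≗ : ∀ n {f g} → (∀ i j → f i j ≡ g i j) → ∑△ n f ≡ ∑△ n g
  ∑△-cong-≗ n f≗g = ∑-cong-≗ n (λ i → ∑-cong-≗ (n ∸ i) (f≗g i))

  private
    ∸-suc : ∀ L i → i < suc L → suc L ∸ i ≡ suc (L ∸ i)
    ∸-suc L i i<1+L = +-∸-assoc 1 (≤-pred i<1+L)

    ∑△-drop-last-row : ∀ L (g : ℕ → ℕ → ℕ) → ∑ (suc L) (λ i → ∑ (L ∸ i) (g i)) ≡ ∑△ L g
    ∑△-drop-last-row L g = trans (cong (λ n → ∑△ L g + ∑ n (g L)) (n∸n≡0 L)) (+-identityʳ _)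

  ∑△-top-row : ∀ L f → ∑△ (suc L) f ≡ ∑ (suc L) (f 0) + ∑△ L (λ i → f (suc i))
  ∑△-top-row L f = ∑-head L (λ i → ∑ (suc L ∸ i) (f i))

  ∑△-left-column : ∀ L f → ∑△ (suc L) f ≡ ∑ (suc L) (λ i → f i 0) + ∑△ L (λ i j → f i (suc j))
  ∑△-left-column L f = begin
    ∑△ (suc L) f                                                               ≡⟨ ∑-cong (suc L) (λ i i<1+L → trans (cong (λ n → ∑ n (f i)) (∸-suc L i i<1+L)) (∑-head (L ∸ i) (f i))) ⟩
    ∑ (suc L) (λ i → f i 0 + ∑ (L ∸ i) (λ j → f i (suc j)))                     ≡⟨ ∑-+ (suc L) (λ i → f i 0) (λ i → ∑ (L ∸ i) (λ j → f i (suc j))) ⟩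
    ∑ (suc L) (λ i → f i 0) + ∑ (suc L) (λ i → ∑ (L ∸ i) (λ j → f i (suc j)))   ≡⟨ cong (∑ (suc L) (λ i → f i 0) +_) (∑△-drop-last-row L (λ i j → f i (suc j))) ⟩
    ∑ (suc L) (λ i → f i 0) + ∑△ L (λ i j → f i (suc j))                        ∎

  ∑△-antidiagonal : ∀ L f → ∑△ (suc L) f ≡ ∑ (suc L) (λ i → f i (L ∸ i)) + ∑△ L f
  ∑△-antidiagonal L f = begin
    ∑△ (suc L) f                                                   ≡⟨ ∑-cong (suc L) (λ i i<1+L → trans (cong (λ n → ∑ n (f i)) (∸-suc L i i<1+L)) (+-comm _ (f i (L ∸ i)))) ⟩
    ∑ (suc L) (λ i → f i (L ∸ i) + ∑ (L ∸ i) (f i))                ≡⟨ ∑-+ (suc L) (λ i → f i (L ∸ i)) (λ i → ∑ (L ∸ i) (f i)) ⟩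
    ∑ (suc L) (λ i → f i (L ∸ i)) + ∑ (suc L) (λ i → ∑ (L ∸ i) (f i)) ≡⟨ cong (∑ (suc L) (λ i → f i (L ∸ i)) +_) (∑△-drop-last-row L f) ⟩
    ∑ (suc L) (λ i → f i (L ∸ i)) + ∑△ L f                         ∎

  module _ {a p} {A : Set a} {P : Pred A p} (P? : Decidable P) where

    private
      length-filter-[_] : ∀ x → length (filter P? [ x ]) ≡ ⟦ P? x ⟧
      length-filter-[ x ] with does (P? x)
      ... | true  = refl
      ... | false = refl

      length-filter-++ : ∀ xs ys → length (filter P? (xs ++ ys)) ≡ length (filter P? xs) + length (filter P? ys)
      length-filter-++ xs ys = trans (cong length (filter-++ P? xs ys)) (length-++ (filter P? xs))

    length-filter-map-upTo : ∀ (h : ℕ → A) n → length (filter P? (map h (upTo n))) ≡ ∑ n (λ j → ⟦ P? (h j) ⟧)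
    length-filter-map-upTo h zero    = refl
    length-filter-map-upTo h (suc n) = begin
      length (filter P? (map h (upTo (suc n))))                    ≡⟨ cong (λ xs → length (filter P? (map h xs))) (upTo-∷ʳ n) ⟨
      length (filter P? (map h (upTo n ++ [ n ])))                 ≡⟨ cong (λ xs → length (filter P? xs)) (map-++ h (upTo n) [ n ]) ⟩
      length (filter P? (map h (upTo n) ++ [ h n ]))               ≡⟨ length-filter-++ (map h (upTo n)) [ h n ] ⟩
      length (filter P? (map h (upTo n))) + length (filter P? [ h n ]) ≡⟨ cong₂ _+_ (length-filter-map-upTo h n) length-filter-[ h n ] ⟩
      ∑ (suc n) (λ j → ⟦ P? (h j) ⟧)                               ∎

    length-filter-concatMap-upTo : ∀ (g : ℕ → List A) n → length (filter P? (concatMap g (upTo n))) ≡ ∑ n (λ i → length (filter P? (g i)))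
    length-filter-concatMap-upTo g zero    = refl
    length-filter-concatMap-upTo g (suc n) = begin
      length (filter P? (concatMap g (upTo (suc n))))                       ≡⟨ cong (λ xs → length (filter P? (concatMap g xs))) (upTo-∷ʳ n) ⟨
      length (filter P? (concatMap g (upTo n ++ [ n ])))                    ≡⟨ cong (λ xs → length (filter P? xs)) (concatMap-++ g (upTo n) [ n ]) ⟩
      length (filter P? (concatMap g (upTo n) ++ (g n ++ [])))              ≡⟨ length-filter-++ (concatMap g (upTo n)) (g n ++ []) ⟩
      length (filter P? (concatMap g (upTo n))) + length (filter P? (g n ++ [])) ≡⟨ cong₂ _+_ (length-filter-concatMap-upTo g n) (cong (λ xs → length (filter P? xs)) (++-identityʳ (g n))) ⟩
      ∑ (suc n) (λ i → length (filter P? (g i)))                           ∎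

  length-filter-indices : ∀ {p} {P : Pred (ℕ × ℕ) p} (P? : Decidable P) n → length (filter P? (indices n)) ≡ ∑△ n (λ i j → ⟦ P? (i , j) ⟧)
  length-filter-indices P? n = trans
    (length-filter-concatMap-upTo P? (λ i → map (i ,_) (upTo (n ∸ i))) n)
    (∑-cong-≗ n (λ i → length-filter-map-upTo P? (i ,_) (n ∸ i)))

module TriangleAveraging where

  open import Data.Nat
  open import Data.Nat.Properties
  open import Relation.Binary.PropositionalEquality
  open ≡-Reasoning
  open FiniteSums

  module _
    (G : ℕ → ℕ → ℕ) (L K : ℕ)
    (rows : ∀ a b → ∑ (suc L) (λ j → G a (b + j)) ≡ K)
    (columns : ∀ a b → ∑ (suc L) (λ i → G (a + i) b) ≡ K)
    (antidiagonals : ∀ a b → ∑ (suc L) (λ i → G (a + i) (b + (L ∸ i))) ≡ K)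
    where

    shifted : ℕ → ℕ → ℕ
    shifted a b = ∑△ (suc L) (λ i j → G (a + i) (b + j))

    -- Peeling the antidiagonal off the translated triangle and the first row (column) off the
    -- original one leaves the same smaller triangle, and both peeled lines sum to K.
    shifted-suc-row : ∀ a b → shifted (suc a) b ≡ shifted a b
    shifted-suc-row a b = begin
      shifted (suc a) b                                                            ≡⟨ ∑△-antidiagonal L (λ i j → G (suc a + i) (b + j)) ⟩
      ∑ (suc L) (λ i → G (suc a + i) (b + (L ∸ i))) + ∑△ L (λ i j → G (suc a + i) (b + j)) ≡⟨ cong₂ _+_ (antidiagonals (suc a) b) (∑△-cong-≗ L (λ i j → cong (λ x → G x (b + j)) (sym (+-suc a i)))) ⟩
      K + ∑△ L (λ i j → G (a + suc i) (b + j))                                      ≡⟨ cong (_+ ∑△ L (λ i j → G (a + suc i) (b + j))) (rows (a + 0) b) ⟨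
      ∑ (suc L) (λ j → G (a + 0) (b + j)) + ∑△ L (λ i j → G (a + suc i) (b + j))    ≡⟨ ∑△-top-row L (λ i j → G (a + i) (b + j)) ⟨
      shifted a b                                                                  ∎

    shifted-suc-column : ∀ a b → shifted a (suc b) ≡ shifted a b
    shifted-suc-column a b = begin
      shifted a (suc b)                                                            ≡⟨ ∑△-antidiagonal L (λ i j → G (a + i) (suc b + j)) ⟩
      ∑ (suc L) (λ i → G (a + i) (suc b + (L ∸ i))) + ∑△ L (λ i j → G (a + i) (suc b + j)) ≡⟨ cong₂ _+_ (antidiagonals a (suc b)) (∑△-cong-≗ L (λ i j → cong (G (a + i)) (sym (+-suc b j)))) ⟩
      K + ∑△ L (λ i j → G (a + i) (b + suc j))                                      ≡⟨ cong (_+ ∑△ L (λ i j → G (a + i) (b + suc j))) (columns a (b + 0)) ⟨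
      ∑ (suc L) (λ i → G (a + i) (b + 0)) + ∑△ L (λ i j → G (a + i) (b + suc j))    ≡⟨ ∑△-left-column L (λ i j → G (a + i) (b + j)) ⟨
      shifted a b                                                                  ∎

    shifted-constant : ∀ a b → shifted a b ≡ ∑△ (suc L) G
    shifted-constant (suc a) b       = trans (shifted-suc-row a b) (shifted-constant a b)
    shifted-constant zero    (suc b) = trans (shifted-suc-column 0 b) (shifted-constant 0 b)
    shifted-constant zero    zero    = refl

    ∑△-average : ∀ N K′ → (∀ a b → ∑ N (λ j → G a (b + j)) ≡ K′) → N * (N * ∑△ (suc L) G) ≡ ∑△ (suc L) (λ _ _ → N * K′)
    ∑△-average N K′ short-rows = begin
      N * (N * ∑△ (suc L) G)                                                                 ≡⟨ cong (N *_) (∑-const N _) ⟨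
      N * ∑ N (λ _ → ∑△ (suc L) G)                                                           ≡⟨ ∑-const N _ ⟨
      ∑ N (λ _ → ∑ N (λ _ → ∑△ (suc L) G))                                                   ≡⟨ ∑-cong-≗ N (λ a → ∑-cong-≗ N (λ b → shifted-constant a b)) ⟨
      ∑ N (λ a → ∑ N (λ b → ∑ (suc L) (λ i → ∑ (suc L ∸ i) (λ j → G (a + i) (b + j)))))       ≡⟨ ∑-cong-≗ N (λ a → ∑-swap N (suc L) (λ b i → ∑ (suc L ∸ i) (λ j → G (a + i) (b + j)))) ⟩
      ∑ N (λ a → ∑ (suc L) (λ i → ∑ N (λ b → ∑ (suc L ∸ i) (λ j → G (a + i) (b + j)))))       ≡⟨ ∑-swap N (suc L) (λ a i → ∑ N (λ b → ∑ (suc L ∸ i) (λ j → G (a + i) (b + j)))) ⟩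
      ∑ (suc L) (λ i → ∑ N (λ a → ∑ N (λ b → ∑ (suc L ∸ i) (λ j → G (a + i) (b + j)))))       ≡⟨ ∑-cong-≗ (suc L) (λ i → ∑-cong-≗ N (λ a → ∑-swap N (suc L ∸ i) (λ b j → G (a + i) (b + j)))) ⟩
      ∑ (suc L) (λ i → ∑ N (λ a → ∑ (suc L ∸ i) (λ j → ∑ N (λ b → G (a + i) (b + j)))))       ≡⟨ ∑-cong-≗ (suc L) (λ i → ∑-swap N (suc L ∸ i) (λ a j → ∑ N (λ b → G (a + i) (b + j)))) ⟩
      ∑△ (suc L) (λ i j → ∑ N (λ a → ∑ N (λ b → G (a + i) (b + j))))                          ≡⟨ ∑△-cong-≗ (suc L) (λ i j → trans (∑-cong-≗ N (λ a → row-sum (a + i) j)) (∑-const N K′)) ⟩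
      ∑△ (suc L) (λ _ _ → N * K′)                                                            ∎
      where
      row-sum : ∀ a j → ∑ N (λ b → G a (b + j)) ≡ K′
      row-sum a j = trans (∑-cong-≗ N (λ b → cong (G a) (+-comm b j))) (short-rows a j)

module Congruence where

  open import Data.Nat as ℕ using (ℕ; suc; NonZero)
  import Data.Nat.Properties as ℕ
  open import Data.Nat.DivMod using (m<n⇒m%n≡m)
  open import Data.Integer using (ℤ; +_; -[1+_]; _+_; _*_; -_; _-_)
  open import Data.Integer.Properties using (+-injective; pos-+; pos-*; *-cancelˡ-≡; *-comm)
  open import Data.Integer.DivMod using (_%ℕ_; _/ℕ_; a≡a%ℕn+[a/ℕn]*n; n%ℕd<d)
  open import Data.Integer.Tactic.RingSolver using (solve-∀)
  open import Relation.Binary.PropositionalEquality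
  open import Relation.Nullary using (contradiction)
  open import Relation.Binary using (Setoid)
  import Relation.Binary.Reasoning.Setoid as SetoidReasoning
  open import Level using (0ℓ)
  open import Function using (_⇔_; mk⇔)

  infix 4 _≡_mod_

  record _≡_mod_ (x y M : ℤ) : Set where
    constructor congruent
    field
      quotient : ℤ
      difference : x ≡ y + quotient * M

  module _ {M : ℤ} where

    ≡mod-reflexive : ∀ {x y} → x ≡ y → x ≡ y mod M
    ≡mod-reflexive {x} refl = congruent (+ 0) (x≡x+0M x M)
      where
      x≡x+0M : ∀ x M → x ≡ x + + 0 * M
      x≡x+0M = solve-∀

    ≡mod-refl : ∀ {x} → x ≡ x mod M
    ≡mod-refl = ≡mod-reflexive refl

    ≡mod-sym : ∀ {x y} → x ≡ y mod M → y ≡ x mod M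
    ≡mod-sym {y = y} (congruent q refl) = congruent (- q) (identity y q M)
      where
      identity : ∀ y q M → y ≡ y + q * M + - q * M
      identity = solve-∀

    ≡mod-trans : ∀ {x y z} → x ≡ y mod M → y ≡ z mod M → x ≡ z mod M
    ≡mod-trans {z = z} (congruent q refl) (congruent q′ refl) = congruent (q′ + q) (identity z q q′ M)
      where
      identity : ∀ z q q′ M → z + q′ * M + q * M ≡ z + (q′ + q) * M
      identity = solve-∀

    ≡mod-+ : ∀ {x y x′ y′} → x ≡ y mod M → x′ ≡ y′ mod M → x + x′ ≡ y + y′ mod M
    ≡mod-+ {y = y} {y′ = y′} (congruent q refl) (congruent q′ refl) = congruent (q + q′) (identity y y′ q q′ M)
      where
      identity : ∀ y y′ q q′ M → y + q * M + (y′ + q′ * M) ≡ y + y′ + (q + q′) * M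
      identity = solve-∀

    ≡mod-neg : ∀ {x y} → x ≡ y mod M → - x ≡ - y mod M
    ≡mod-neg {y = y} (congruent q refl) = congruent (- q) (identity y q M)
      where
      identity : ∀ y q M → - (y + q * M) ≡ - y + - q * M
      identity = solve-∀

    ≡mod-*ˡ : ∀ c {x y} → x ≡ y mod M → c * x ≡ c * y mod M
    ≡mod-*ˡ c {y = y} (congruent q refl) = congruent (c * q) (identity c y q M)
      where
      identity : ∀ c y q M → c * (y + q * M) ≡ c * y + c * q * M
      identity = solve-∀

    ≡mod-*ʳ : ∀ c {x y} → x ≡ y mod M → x * c ≡ y * c mod M
    ≡mod-*ʳ c {x} {y} x≡y = ≡mod-trans (≡mod-reflexive (*-comm x c)) (≡mod-trans (≡mod-*ˡ c x≡y) (≡mod-reflexive (*-comm c y)))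

  ≡mod-setoid : ℤ → Setoid 0ℓ 0ℓ
  ≡mod-setoid M = record
    { _≈_           = λ x y → x ≡ y mod M
    ; isEquivalence = record { refl = ≡mod-refl ; sym = ≡mod-sym ; trans = ≡mod-trans }
    }

  module ≡mod-Reasoning (M : ℤ) = SetoidReasoning (≡mod-setoid M)

  ≡mod-divisor : ∀ {x y} M c → x ≡ y mod (M * c) → x ≡ y mod M
  ≡mod-divisor {y = y} M c (congruent q refl) = congruent (q * c) (identity y q M c)
    where
    identity : ∀ y q M c → y + q * (M * c) ≡ y + q * c * M
    identity = solve-∀

  ≡mod-+-cancelˡ-⇔ : ∀ {M} x {a b} → (x + a ≡ x + b mod M) ⇔ (a ≡ b mod M)
  ≡mod-+-cancelˡ-⇔ {M} x {a} {b} = mk⇔ cancel (≡mod-+ (≡mod-refl {x = x}))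
    where
    cancel : x + a ≡ x + b mod M → a ≡ b mod M
    cancel (congruent q eq) = congruent q (trans (solve₁ x a) (trans (cong (_- x) eq) (solve₂ x b q M)))
      where
      solve₁ : ∀ x a → a ≡ x + a - x
      solve₁ = solve-∀
      solve₂ : ∀ x b q M → x + b + q * M - x ≡ b + q * M
      solve₂ = solve-∀

  ≡mod-*-cancelˡ-⇔ : ∀ {M} d .{{_ : NonZero d}} {a b} → (+ d * a ≡ + d * b mod (+ d * M)) ⇔ (a ≡ b mod M)
  ≡mod-*-cancelˡ-⇔ {M} d {a} {b} = mk⇔ cancel scale
    where
    cancel : + d * a ≡ + d * b mod (+ d * M) → a ≡ b mod M
    cancel (congruent q eq) = congruent q (*-cancelˡ-≡ (+ d) a (b + q * M) (trans eq (identity (+ d) b q M)))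
      where
      identity : ∀ d b q M → d * b + q * (d * M) ≡ d * (b + q * M)
      identity = solve-∀
    scale : a ≡ b mod M → + d * a ≡ + d * b mod (+ d * M)
    scale (congruent q refl) = congruent q (identity (+ d) b q M)
      where
      identity : ∀ d b q M → d * (b + q * M) ≡ d * b + q * (d * M)
      identity = solve-∀

  private
    +a≡+b+[1+k]m⇒m≤a : ∀ a b k m → + a ≡ + b + + suc k * + m → m ℕ.≤ a
    +a≡+b+[1+k]m⇒m≤a a b k m a≡b+km = ℕ.≤-trans (ℕ.m≤n+m m (b ℕ.+ k ℕ.* m)) (ℕ.≤-reflexive (sym (+-injective eq)))
      where
      eq : + a ≡ + (b ℕ.+ k ℕ.* m ℕ.+ m)
      eq = trans a≡b+km (trans (cong (_+_ (+ b)) (sym (pos-* (suc k) m))) (trans (sym (pos-+ b (suc k ℕ.* m))) (cong +_ (lemma b k m))))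
        where
        lemma : ∀ b k m → b ℕ.+ suc k ℕ.* m ≡ b ℕ.+ k ℕ.* m ℕ.+ m
        lemma b k m = trans (cong (b ℕ.+_) (ℕ.+-comm m (k ℕ.* m))) (sym (ℕ.+-assoc b (k ℕ.* m) m))

    remainder-unique : ∀ a b k m → a ℕ.< m → b ℕ.< m → + a ≡ + b + k * + m → a ≡ b
    remainder-unique a b (+ 0) m _ _ a≡b+0m = +-injective (trans a≡b+0m (b+0m≡b (+ b) (+ m)))
      where
      b+0m≡b : ∀ b m → b + + 0 * m ≡ b
      b+0m≡b = solve-∀
    remainder-unique a b (+ suc k) m a<m _ a≡b+km = contradiction (a<m) (ℕ.≤⇒≯ (+a≡+b+[1+k]m⇒m≤a a b k m a≡b+km))
    remainder-unique a b -[1+ k ] m _ b<m a≡b-km = contradiction b<m (ℕ.≤⇒≯ (+a≡+b+[1+k]m⇒m≤a b a k m b≡a+km))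
      where
      b≡a+km : + b ≡ + a + + suc k * + m
      b≡a+km = trans (identity (+ b) (+ suc k) (+ m)) (cong (_+ + suc k * + m) (sym a≡b-km))
        where
        identity : ∀ b k m → b ≡ b + - k * m + k * m
        identity = solve-∀

  module _ (m : ℕ) .{{_ : NonZero m}} where

    %ℕ-≡mod : ∀ x → + (x %ℕ m) ≡ x mod + m
    %ℕ-≡mod x = congruent (- (x /ℕ m)) (trans (identity (+ (x %ℕ m)) (x /ℕ m) (+ m)) (cong (_+ - (x /ℕ m) * + m) (sym (a≡a%ℕn+[a/ℕn]*n x m))))
      where
      identity : ∀ r q M → r ≡ r + q * M + - q * M
      identity = solve-∀

    %ℕ-≡⇒≡mod : ∀ {x y} → x %ℕ m ≡ y %ℕ m → x ≡ y mod + m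
    %ℕ-≡⇒≡mod {x} {y} eq = ≡mod-trans (≡mod-sym (%ℕ-≡mod x)) (≡mod-trans (≡mod-reflexive (cong +_ eq)) (%ℕ-≡mod y))

    ≡mod⇒%ℕ-≡ : ∀ {x y} → x ≡ y mod + m → x %ℕ m ≡ y %ℕ m
    ≡mod⇒%ℕ-≡ {x} {y} x≡y = remainder-unique (x %ℕ m) (y %ℕ m) q m (n%ℕd<d x m) (n%ℕd<d y m) difference
      where
      open _≡_mod_ (≡mod-trans (%ℕ-≡mod x) (≡mod-trans x≡y (≡mod-sym (%ℕ-≡mod y)))) renaming (quotient to q)

    ≡mod⇒%ℕ≡ : ∀ {x r} → r ℕ.< m → x ≡ + r mod + m → x %ℕ m ≡ r
    ≡mod⇒%ℕ≡ r<m x≡r = trans (≡mod⇒%ℕ-≡ x≡r) (m<n⇒m%n≡m r<m)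

    %ℕ≡⇒≡mod : ∀ {x r} → r ℕ.< m → x %ℕ m ≡ r → x ≡ + r mod + m
    %ℕ≡⇒≡mod r<m x%m≡r = %ℕ-≡⇒≡mod (trans x%m≡r (sym (m<n⇒m%n≡m r<m)))

    %ℕ≡⇔≡mod : ∀ {x r} → r ℕ.< m → (x %ℕ m ≡ r) ⇔ (x ≡ + r mod + m)
    %ℕ≡⇔≡mod r<m = mk⇔ (%ℕ≡⇒≡mod r<m) (≡mod⇒%ℕ≡ r<m)

module Units where

  open import Data.Nat as ℕ using (ℕ; NonZero; _%_; _/_)
  import Data.Nat.Properties as ℕ
  open import Data.Nat.DivMod using (m≡m%n+[m/n]*n)
  open import Data.Nat.Divisibility using (_∣_; divides; ∣1⇒≡1; ∣-refl)
  open import Data.Nat.GCD using (gcd; gcd-GCD; gcd[m,n]∣m; gcd[m,n]∣n; gcd-greatest; c*gcd[m,n]≡gcd[cm,cn]; module Bézout)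
  open import Data.Integer using (ℤ; +_; _+_; _*_; -_; _-_; ∣_∣)
  open import Data.Integer.Properties using (pos-*; +∣i∣≡i⊎+∣i∣≡-i; neg-involutive; abs-*; +-identityˡ)
  open import Data.Integer.DivMod using (_%ℕ_; _/ℕ_; a≡a%ℕn+[a/ℕn]*n)
  open import Data.Integer.Tactic.RingSolver using (solve-∀)
  open import Data.Sum using (inj₁; inj₂)
  open import Relation.Binary.PropositionalEquality
  open import Function using (_⇔_; mk⇔)
  open Congruence

  record Invertible (M x : ℤ) : Set where
    constructor invertible
    field
      inverse : ℤ
      inverse-correct : x * inverse ≡ + 1 mod M

  module _ {M : ℤ} where

    invertible-* : ∀ {x y} → Invertible M x → Invertible M y → Invertible M (x * y)
    invertible-* {x} {y} (invertible v xv≡1) (invertible w yw≡1) = invertible (v * w) (begin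
      x * y * (v * w)  ≡⟨ identity x y v w ⟩
      y * w * (x * v)  ≈⟨ ≡mod-*ˡ (y * w) xv≡1 ⟩
      y * w * + 1      ≡⟨ *-identityʳ (y * w) ⟩
      y * w            ≈⟨ yw≡1 ⟩
      + 1              ∎)
      where
      open ≡mod-Reasoning M
      identity : ∀ x y v w → x * y * (v * w) ≡ y * w * (x * v)
      identity = solve-∀
      *-identityʳ : ∀ z → z * + 1 ≡ z
      *-identityʳ = solve-∀

    invertible-neg : ∀ {x} → Invertible M x → Invertible M (- x)
    invertible-neg {x} (invertible w xw≡1) = invertible (- w) (≡mod-trans (≡mod-reflexive (identity x w)) xw≡1)
      where
      identity : ∀ x w → - x * - w ≡ x * w
      identity = solve-∀

    invertible-solve-⇔ : ∀ {x} (inv : Invertible M x) {k y} → (k * x ≡ y mod M) ⇔ (k ≡ Invertible.inverse inv * y mod M)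
    invertible-solve-⇔ {x} (invertible w xw≡1) {k} {y} = mk⇔ solve unsolve
      where
      open ≡mod-Reasoning M
      solve : k * x ≡ y mod M → k ≡ w * y mod M
      solve kx≡y = begin
        k                ≡⟨ solve₁ k ⟩
        k * + 1          ≈⟨ ≡mod-*ˡ k xw≡1 ⟨
        k * (x * w)      ≡⟨ solve₂ k x w ⟩
        w * (k * x)      ≈⟨ ≡mod-*ˡ w kx≡y ⟩
        w * y            ∎
        where
        solve₁ : ∀ k → k ≡ k * + 1
        solve₁ = solve-∀
        solve₂ : ∀ k x w → k * (x * w) ≡ w * (k * x)
        solve₂ = solve-∀
      unsolve : k ≡ w * y mod M → k * x ≡ y mod M
      unsolve k≡wy = begin
        k * x            ≡⟨ solve₁ k x ⟩
        x * k            ≈⟨ ≡mod-*ˡ x k≡wy ⟩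
        x * (w * y)      ≡⟨ solve₂ x w y ⟩
        y * (x * w)      ≈⟨ ≡mod-*ˡ y xw≡1 ⟩
        y * + 1          ≡⟨ solve₃ y ⟩
        y                ∎
        where
        solve₁ : ∀ k x → k * x ≡ x * k
        solve₁ = solve-∀
        solve₂ : ∀ x w y → x * (w * y) ≡ y * (x * w)
        solve₂ = solve-∀
        solve₃ : ∀ y → y * + 1 ≡ y
        solve₃ = solve-∀

  1-invertible : ∀ {M} → Invertible M (+ 1)
  1-invertible = invertible (+ 1) ≡mod-refl

  invertible-divisor : ∀ {x} M c → Invertible (M * c) x → Invertible M x
  invertible-divisor M c (invertible w xw≡1) = invertible w (≡mod-divisor M c xw≡1)

  gcd≡1⇒invertible : ∀ a m → gcd a m ≡ 1 → Invertible (+ m) (+ a)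
  gcd≡1⇒invertible a m gcd≡1 with subst (λ d → Bézout.Identity d a m) gcd≡1 (Bézout.identity (gcd-GCD a m))
  ... | Bézout.+- x y eq = invertible (+ x) (congruent (+ y) (begin
    + a * + x          ≡⟨ sym (pos-* a x) ⟩
    + (a ℕ.* x)        ≡⟨ cong +_ (trans (ℕ.*-comm a x) (sym eq)) ⟩
    + (1 ℕ.+ y ℕ.* m)  ≡⟨ cong (_+_ (+ 1)) (pos-* y m) ⟩
    + 1 + + y * + m    ∎))
    where open ≡-Reasoning
  ... | Bézout.-+ x y eq = invertible (- + x) (congruent (- + y) (identity (+ a) (+ x) (+ y) (+ m) (trans (cong (_+_ (+ 1)) (sym (pos-* x a))) (trans (cong +_ eq) (pos-* y m)))))
    where
    identity : ∀ a x y m → + 1 + x * a ≡ y * m → a * - x ≡ + 1 + - y * m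
    identity a x y m eq = trans (solve₁ a x) (trans (cong (λ z → + 1 - z) eq) (solve₂ y m))
      where
      solve₁ : ∀ a x → a * - x ≡ + 1 - (+ 1 + x * a)
      solve₁ = solve-∀
      solve₂ : ∀ y m → + 1 - y * m ≡ + 1 + - y * m
      solve₂ = solve-∀

  2-invertible : ∀ m → m % 2 ≡ 1 → Invertible (+ m) (+ 2)
  2-invertible m m-odd = invertible (- + (m / 2)) (congruent (- + 1) (trans (identity (+ (m / 2))) (cong (λ z → + 1 + - + 1 * z) (sym m≡1+2t))))
    where
    identity : ∀ t → + 2 * - t ≡ + 1 + - + 1 * (+ 1 + + 2 * t)
    identity = solve-∀
    m≡1+2t : + m ≡ + 1 + + 2 * + (m / 2)
    m≡1+2t = trans (cong +_ (trans (m≡m%n+[m/n]*n m 2) (cong₂ ℕ._+_ m-odd (ℕ.*-comm (m / 2) 2)))) (cong (_+_ (+ 1)) (pos-* 2 (m / 2)))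

  gcd≡1⇒%ℕ≢0 : ∀ a d .{{_ : NonZero d}} → gcd ∣ a ∣ d ≡ 1 → d ≢ 1 → a %ℕ d ≢ 0
  gcd≡1⇒%ℕ≢0 a d gcd≡1 d≢1 a%d≡0 = d≢1 (∣1⇒≡1 (subst (d ∣_) gcd≡1 (gcd-greatest d∣∣a∣ ∣-refl)))
    where
    d∣∣a∣ : d ∣ ∣ a ∣
    d∣∣a∣ = divides ∣ a /ℕ d ∣ (trans (cong ∣_∣ (trans (a≡a%ℕn+[a/ℕn]*n a d) (trans (cong (λ r → + r + a /ℕ d * + d) a%d≡0) (+-identityˡ (a /ℕ d * + d))))) (abs-* (a /ℕ d) (+ d)))

  record ScaledUnit (m d : ℕ) (e : ℤ) : Set where
    field
      cofactor        : ℕ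
      m≡d*cofactor    : m ≡ d ℕ.* cofactor
      unit            : ℤ
      e≡d*unit        : e ≡ + d * unit
      unit-invertible : Invertible (+ cofactor) unit

  ScaledUnit-neg : ∀ {m d e} → ScaledUnit m d e → ScaledUnit m d (- e)
  ScaledUnit-neg {m} {d} s = record
    { cofactor        = cofactor
    ; m≡d*cofactor    = m≡d*cofactor
    ; unit            = - unit
    ; e≡d*unit        = trans (cong -_ e≡d*unit) (identity (+ d) unit)
    ; unit-invertible = invertible-neg unit-invertible
    }
    where
    open ScaledUnit s
    identity : ∀ d u → - (d * u) ≡ d * - u
    identity = solve-∀

  ScaledUnit-∣∣ : ∀ {m d} e → ScaledUnit m d (+ ∣ e ∣) → ScaledUnit m d e
  ScaledUnit-∣∣ e s with +∣i∣≡i⊎+∣i∣≡-i e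
  ... | inj₁ ∣e∣≡e  = subst (ScaledUnit _ _) ∣e∣≡e s
  ... | inj₂ ∣e∣≡-e = subst (ScaledUnit _ _) (neg-involutive e) (ScaledUnit-neg (subst (ScaledUnit _ _) ∣e∣≡-e s))

  ScaledUnit-*-invertible : ∀ {m d e σ} → ScaledUnit m d e → Invertible (+ m) σ → ScaledUnit m d (e * σ)
  ScaledUnit-*-invertible {m} {d} {e} {σ} s σ-invertible = record
    { cofactor        = cofactor
    ; m≡d*cofactor    = m≡d*cofactor
    ; unit            = unit * σ
    ; e≡d*unit        = trans (cong (_* σ) e≡d*unit) (identity (+ d) unit σ)
    ; unit-invertible = invertible-* unit-invertible (invertible-divisor (+ cofactor) (+ d) (subst (λ M → Invertible M σ) m≡cofactor*d σ-invertible))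
    }
    where
    open ScaledUnit s
    identity : ∀ d u σ → d * u * σ ≡ d * (u * σ)
    identity = solve-∀
    m≡cofactor*d : + m ≡ + cofactor * + d
    m≡cofactor*d = trans (cong +_ (trans m≡d*cofactor (ℕ.*-comm d cofactor))) (pos-* cofactor d)

  gcd⇒ScaledUnit : ∀ e m .{{_ : NonZero m}} → ScaledUnit m (gcd ∣ e ∣ m) e
  gcd⇒ScaledUnit e m with gcd ∣ e ∣ m in gcd≡d | gcd[m,n]∣m ∣ e ∣ m | gcd[m,n]∣n ∣ e ∣ m
  ... | d | divides b ∣e∣≡b*d | divides m′ m≡m′*d = ScaledUnit-∣∣ e (record
    { cofactor        = m′
    ; m≡d*cofactor    = trans m≡m′*d (ℕ.*-comm m′ d)
    ; unit            = + b
    ; e≡d*unit        = trans (cong +_ (trans ∣e∣≡b*d (ℕ.*-comm b d))) (pos-* d b)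
    ; unit-invertible = gcd≡1⇒invertible b m′ gcd[b,m′]≡1
    })
    where
    instance
      d≢0 : NonZero d
      d≢0 = ℕ.≢-nonZero (λ d≡0 → ℕ.≢-nonZero⁻¹ m (trans m≡m′*d (trans (cong (m′ ℕ.*_) d≡0) (ℕ.*-zeroʳ m′))))

    gcd[b,m′]≡1 : gcd b m′ ≡ 1
    gcd[b,m′]≡1 = ℕ.*-cancelˡ-≡ (gcd b m′) 1 d (begin
      d ℕ.* gcd b m′               ≡⟨ c*gcd[m,n]≡gcd[cm,cn] d b m′ ⟩
      gcd (d ℕ.* b) (d ℕ.* m′)     ≡⟨ cong₂ gcd (trans (ℕ.*-comm d b) (sym ∣e∣≡b*d)) (trans (ℕ.*-comm d m′) (sym m≡m′*d)) ⟩
      gcd ∣ e ∣ m                  ≡⟨ gcd≡d ⟩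
      d                            ≡⟨ ℕ.*-identityʳ d ⟨
      d ℕ.* 1                      ∎)
      where open ≡-Reasoning

module ArithmeticProgressions where

  open import Data.Nat as ℕ using (ℕ; NonZero; _<_; _%_; _≟_)
  import Data.Nat.Properties as ℕ
  open import Data.Nat.DivMod using (m<n⇒m%n≡m; [m+n]%n≡m%n)
  open import Data.Integer using (ℤ; +_; _+_; _*_; -_)
  open import Data.Integer.Properties using (pos-*)
  open import Data.Integer.DivMod using (_%ℕ_; n%ℕd<d)
  open import Data.Integer.Tactic.RingSolver using (solve-∀)
  open import Function using (_∘_; _⇔_; mk⇔)
  open import Function.Properties.Equivalence using (⇔-setoid) renaming (trans to ⇔-trans)
  open import Level using (0ℓ)
  open import Relation.Binary.PropositionalEquality
  import Relation.Binary.Reasoning.Setoid as SetoidReasoning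
  open import Relation.Nullary using (yes; no)
  open FiniteSums
  open Congruence
  open Units

  module _ (m : ℕ) .{{_ : NonZero m}} where

    countAP : ℤ → ℤ → ℕ → ℕ
    countAP x e r = ∑ m (λ k → ⟦ (x + + k * e) %ℕ m ≟ r ⟧)

    hit⇔solution : ∀ {d e} .{{_ : NonZero d}} (s : ScaledUnit m d e) {x r y} → r < m → + r ≡ x + + d * y →
                   ∀ k → ((x + + k * e) %ℕ m ≡ r) ⇔ (+ k ≡ Invertible.inverse (ScaledUnit.unit-invertible s) * y mod + ScaledUnit.cofactor s)
    hit⇔solution {d} {e} s {x} {r} {y} r<m r≡x+dy k = begin
      ((x + + k * e) %ℕ m ≡ r)                                   ≈⟨ %ℕ≡⇔≡mod m r<m ⟩
      (x + + k * e ≡ + r mod + m)                                ≡⟨ cong₃ _≡_mod_ (trans (cong (λ e → x + + k * e) e≡d*unit) (identity x (+ k) (+ d) unit)) r≡x+dy (trans (cong +_ m≡d*cofactor) (pos-* d cofactor)) ⟩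
      (x + + d * (+ k * unit) ≡ x + + d * y mod (+ d * + cofactor)) ≈⟨ ≡mod-+-cancelˡ-⇔ x ⟩
      (+ d * (+ k * unit) ≡ + d * y mod (+ d * + cofactor))      ≈⟨ ≡mod-*-cancelˡ-⇔ d ⟩
      (+ k * unit ≡ y mod + cofactor)                            ≈⟨ invertible-solve-⇔ unit-invertible ⟩
      (+ k ≡ Invertible.inverse unit-invertible * y mod + cofactor) ∎
      where
      open ScaledUnit s
      open SetoidReasoning (⇔-setoid 0ℓ)
      identity : ∀ x k d u → x + k * (d * u) ≡ x + d * (k * u)
      identity = solve-∀
      cong₃ : ∀ {A B C : Set} {D : Set₁} (f : A → B → C → D) {a a′ b b′ c c′} → a ≡ a′ → b ≡ b′ → c ≡ c′ → f a b c ≡ f a′ b′ c′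
      cong₃ f refl refl refl = refl

    countAP-ScaledUnit : ∀ {d e} .{{_ : NonZero d}} → ScaledUnit m d e → ∀ x {r} → r < m → countAP x e r ≡ d ℕ.* ⟦ x %ℕ d ≟ r % d ⟧
    countAP-ScaledUnit {d} {e} s x {r} r<m with x %ℕ d ≟ r % d
    ... | no x≢r = begin
      countAP x e r                 ≡⟨ ∑-cong m (λ k _ → ⟦no⟧ ((x + + k * e) %ℕ m ≟ r) (x≢r ∘ hit⇒x≡r k)) ⟩
      ∑ m (λ _ → 0)                 ≡⟨ ∑-zero m ⟩
      0                             ≡⟨ ℕ.*-zeroʳ d ⟨
      d ℕ.* 0                       ≡⟨ cong (d ℕ.*_) (⟦no⟧ (x %ℕ d ≟ r % d) x≢r) ⟨
      d ℕ.* ⟦ x %ℕ d ≟ r % d ⟧      ∎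
      where
      open ≡-Reasoning
      open ScaledUnit s
      hit⇒x≡r : ∀ k → (x + + k * e) %ℕ m ≡ r → x %ℕ d ≡ r % d
      hit⇒x≡r k hit = ≡mod⇒%ℕ-≡ d (≡mod-trans (≡mod-sym x+ke≡x) (≡mod-divisor (+ d) (+ cofactor) (subst (λ M → x + + k * e ≡ + r mod M) m≡d*m′ (%ℕ≡⇒≡mod m r<m hit))))
        where
        x+ke≡x : x + + k * e ≡ x mod + d
        x+ke≡x = congruent (+ k * unit) (trans (cong (λ e → x + + k * e) e≡d*unit) (identity x (+ k) (+ d) unit))
          where
          identity : ∀ x k d u → x + k * (d * u) ≡ x + k * u * d
          identity = solve-∀
        m≡d*m′ : + m ≡ + d * + cofactor
        m≡d*m′ = trans (cong +_ m≡d*cofactor) (pos-* d cofactor)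
    ... | yes x≡r = begin
      countAP x e r                               ≡⟨ ∑-cong m (λ k _ → ⟦⟧-cong ((x + + k * e) %ℕ m ≟ r) (k % m′ ≟ k₀) (hit⇔ k)) ⟩
      ∑ m (λ k → ⟦ k % m′ ≟ k₀ ⟧)                 ≡⟨ cong (λ n → ∑ n (λ k → ⟦ k % m′ ≟ k₀ ⟧)) m≡d*cofactor ⟩
      ∑ (d ℕ.* m′) (λ k → ⟦ k % m′ ≟ k₀ ⟧)        ≡⟨ ∑-periodic m′ (λ k → ⟦ k % m′ ≟ k₀ ⟧) periodic d ⟩
      d ℕ.* ∑ m′ (λ k → ⟦ k % m′ ≟ k₀ ⟧)          ≡⟨ cong (d ℕ.*_) (∑-cong m′ (λ k k<m′ → cong (λ i → ⟦ i ≟ k₀ ⟧) (m<n⇒m%n≡m k<m′))) ⟩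
      d ℕ.* ∑ m′ (λ k → ⟦ k ≟ k₀ ⟧)               ≡⟨ cong (d ℕ.*_) (∑-⟦≡⟧ m′ (n%ℕd<d (w * y) m′)) ⟩
      d ℕ.* 1                                     ≡⟨ cong (d ℕ.*_) (⟦yes⟧ (x %ℕ d ≟ r % d) x≡r) ⟨
      d ℕ.* ⟦ x %ℕ d ≟ r % d ⟧                    ∎
      where
      open ≡-Reasoning
      open ScaledUnit s renaming (cofactor to m′; unit to u)
      open Invertible unit-invertible renaming (inverse to w)

      instance
        m′≢0 : NonZero m′
        m′≢0 = ℕ.≢-nonZero (λ m′≡0 → ℕ.≢-nonZero⁻¹ m (trans m≡d*cofactor (trans (cong (d ℕ.*_) m′≡0) (ℕ.*-zeroʳ d))))

      open _≡_mod_ (%ℕ-≡⇒≡mod d {x} {+ r} x≡r) renaming (quotient to q; difference to x≡r+qd)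

      y : ℤ
      y = - q

      r≡x+dy : + r ≡ x + + d * y
      r≡x+dy = trans (identity (+ r) q (+ d)) (cong (λ x → x + + d * - q) (sym x≡r+qd))
        where
        identity : ∀ r q d → r ≡ r + q * d + d * - q
        identity = solve-∀

      k₀ : ℕ
      k₀ = (w * y) %ℕ m′

      hit⇔ : ∀ k → ((x + + k * e) %ℕ m ≡ r) ⇔ (k % m′ ≡ k₀)
      hit⇔ k = ⇔-trans (hit⇔solution s {x} r<m r≡x+dy k) (mk⇔ (≡mod⇒%ℕ-≡ m′) (%ℕ-≡⇒≡mod m′ {+ k} {w * y}))

      periodic : ∀ k → ⟦ (m′ ℕ.+ k) % m′ ≟ k₀ ⟧ ≡ ⟦ k % m′ ≟ k₀ ⟧
      periodic k = cong (λ i → ⟦ i ≟ k₀ ⟧) (trans (cong (_% m′) (ℕ.+-comm m′ k)) ([m+n]%n≡m%n k m′))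

module ClosedForm where

  open import Data.Nat as ℕ using (ℕ; zero; suc)
  open import Data.Integer using (ℤ; +_; _+_; _*_; -_; _-_)
  open import Data.Integer.Tactic.RingSolver using (solve-∀)
  open import Data.Product using (_×_; _,_; proj₁; proj₂)
  open import Relation.Binary.PropositionalEquality
  open import Defs using (tri)

  data Residue3 : Set where
    0₃ 1₃ 2₃ : Residue3

  suc₃ : Residue3 → Residue3
  suc₃ 0₃ = 1₃
  suc₃ 1₃ = 2₃
  suc₃ 2₃ = 0₃

  pred₃ : Residue3 → Residue3
  pred₃ 0₃ = 2₃
  pred₃ 1₃ = 0₃
  pred₃ 2₃ = 1₃

  _-₃_ : Residue3 → Residue3 → Residue3
  0₃ -₃ 0₃ = 0₃
  1₃ -₃ 1₃ = 0₃
  2₃ -₃ 2₃ = 0₃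
  1₃ -₃ 0₃ = 1₃
  2₃ -₃ 1₃ = 1₃
  0₃ -₃ 2₃ = 1₃
  2₃ -₃ 0₃ = 2₃
  0₃ -₃ 1₃ = 2₃
  1₃ -₃ 2₃ = 2₃

  suc₃-₃ : ∀ β α → suc₃ β -₃ α ≡ suc₃ (β -₃ α)
  suc₃-₃ 0₃ 0₃ = refl
  suc₃-₃ 0₃ 1₃ = refl
  suc₃-₃ 0₃ 2₃ = refl
  suc₃-₃ 1₃ 0₃ = refl
  suc₃-₃ 1₃ 1₃ = refl
  suc₃-₃ 1₃ 2₃ = refl
  suc₃-₃ 2₃ 0₃ = refl
  suc₃-₃ 2₃ 1₃ = refl
  suc₃-₃ 2₃ 2₃ = refl

  -₃suc₃ : ∀ β α → β -₃ suc₃ α ≡ pred₃ (β -₃ α)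
  -₃suc₃ 0₃ 0₃ = refl
  -₃suc₃ 0₃ 1₃ = refl
  -₃suc₃ 0₃ 2₃ = refl
  -₃suc₃ 1₃ 0₃ = refl
  -₃suc₃ 1₃ 1₃ = refl
  -₃suc₃ 1₃ 2₃ = refl
  -₃suc₃ 2₃ 0₃ = refl
  -₃suc₃ 2₃ 1₃ = refl
  -₃suc₃ 2₃ 2₃ = refl

  carry : Residue3 → ℕ
  carry 2₃ = 1
  carry _  = 0

  -- (i / 3 , i mod 3) by recursion on i, so that passing from i to i + 1 computes by cases on the residue.
  divMod3 : ℕ → ℕ × Residue3
  divMod3 zero    = 0 , 0₃
  divMod3 (suc i) = let (q , ρ) = divMod3 i in carry ρ ℕ.+ q , suc₃ ρ

  divMod3-+3 : ∀ i → divMod3 (3 ℕ.+ i) ≡ (suc (proj₁ (divMod3 i)) , proj₂ (divMod3 i))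
  divMod3-+3 i with divMod3 i
  ... | q , 0₃ = refl
  ... | q , 1₃ = refl
  ... | q , 2₃ = refl

  class : ℕ → ℕ → Residue3
  class i j = proj₂ (divMod3 j) -₃ proj₂ (divMod3 i)

  class-sucˡ : ∀ i j → class (suc i) j ≡ pred₃ (class i j)
  class-sucˡ i j = -₃suc₃ (proj₂ (divMod3 j)) (proj₂ (divMod3 i))

  class-sucʳ : ∀ i j → class i (suc j) ≡ suc₃ (class i j)
  class-sucʳ i j = suc₃-₃ (proj₂ (divMod3 j)) (proj₂ (divMod3 i))

  class-+3ˡ : ∀ i j → class (3 ℕ.+ i) j ≡ class i j
  class-+3ˡ i j = cong (λ x → proj₂ (divMod3 j) -₃ proj₂ x) (divMod3-+3 i)

  class-+3ʳ : ∀ i j → class i (3 ℕ.+ j) ≡ class i j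
  class-+3ʳ i j = cong (λ x → proj₂ x -₃ proj₂ (divMod3 i)) (divMod3-+3 j)

  Satisfies∇ : (ℕ → ℕ → ℤ) → Set
  Satisfies∇ Ψ = ∀ i j → Ψ (suc i) j ≡ - Ψ i j - Ψ i (suc j)

  tri-Satisfies∇ : ∀ {Ψ} → Satisfies∇ Ψ → ∀ i j → tri (Ψ 0) i j ≡ Ψ i j
  tri-Satisfies∇     ∇Ψ zero    j = refl
  tri-Satisfies∇ {Ψ} ∇Ψ (suc i) j = trans (cong₂ (λ x y → - x - y) (tri-Satisfies∇ {Ψ} ∇Ψ i j) (tri-Satisfies∇ {Ψ} ∇Ψ i (suc j))) (sym (∇Ψ i j))

  Satisfies∇-linear : ∀ a b {Ψ Ψ′} → Satisfies∇ Ψ → Satisfies∇ Ψ′ → Satisfies∇ (λ i j → a * Ψ i j + b * Ψ′ i j)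
  Satisfies∇-linear a b {Ψ} {Ψ′} ∇Ψ ∇Ψ′ i j = trans (cong₂ (λ x y → a * x + b * y) (∇Ψ i j) (∇Ψ′ i j)) (identity a b (Ψ i j) (Ψ i (suc j)) (Ψ′ i j) (Ψ′ i (suc j)))
    where
    identity : ∀ a b x y x′ y′ → a * (- x - y) + b * (- x′ - y′) ≡ - (a * x + b * x′) - (a * y + b * y′)
    identity = solve-∀

  A₁-pattern : Residue3 → ℤ
  A₁-pattern 0₃ = + 1
  A₁-pattern 1₃ = + 0
  A₁-pattern 2₃ = - + 1

  Ψ₁ : ℕ → ℕ → ℤ
  Ψ₁ i j = A₁-pattern (class i j)

  Ψ₁-∇ : Satisfies∇ Ψ₁
  Ψ₁-∇ i j rewrite class-sucˡ i j | class-sucʳ i j = pattern-∇ (class i j)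
    where
    pattern-∇ : ∀ c → A₁-pattern (pred₃ c) ≡ - A₁-pattern c - A₁-pattern (suc₃ c)
    pattern-∇ 0₃ = refl
    pattern-∇ 1₃ = refl
    pattern-∇ 2₃ = refl

  columnStep : Residue3 → ℤ
  columnStep 0₃ = + 1
  columnStep 1₃ = + 1
  columnStep 2₃ = - + 2

  rowStep : Residue3 → ℤ
  rowStep 0₃ = - + 1
  rowStep 1₃ = + 2
  rowStep 2₃ = - + 1

  antidiagonalStep : Residue3 → ℤ
  antidiagonalStep c = columnStep c - rowStep c

  offset : Residue3 → Residue3 → ℤ
  offset 0₃ 0₃ = + 0
  offset 1₃ 1₃ = + 0
  offset 2₃ 2₃ = + 0
  offset 0₃ 1₃ = + 1
  offset 1₃ 2₃ = + 2
  offset 2₃ 0₃ = + 1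
  offset 0₃ 2₃ = - + 1
  offset 1₃ 0₃ = - + 1
  offset 2₃ 1₃ = - + 2

  H : ℕ × Residue3 → ℕ × Residue3 → ℤ
  H (p , α) (q , β) = + p * columnStep (β -₃ α) + + q * rowStep (β -₃ α) + offset α β

  Ψ₂ : ℕ → ℕ → ℤ
  Ψ₂ i j = H (divMod3 i) (divMod3 j)

  columnStep-∇ : ∀ c → columnStep (pred₃ c) ≡ - columnStep c - columnStep (suc₃ c)
  columnStep-∇ 0₃ = refl
  columnStep-∇ 1₃ = refl
  columnStep-∇ 2₃ = refl

  rowStep-∇ : ∀ c → rowStep (pred₃ c) ≡ - rowStep c - rowStep (suc₃ c)
  rowStep-∇ 0₃ = refl
  rowStep-∇ 1₃ = refl
  rowStep-∇ 2₃ = refl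

  offset-∇ : ∀ α β → offset (suc₃ α) β ≡ - offset α β - (+ carry β * rowStep (suc₃ (β -₃ α)) + offset α (suc₃ β)) - + carry α * columnStep (pred₃ (β -₃ α))
  offset-∇ 0₃ 0₃ = refl
  offset-∇ 0₃ 1₃ = refl
  offset-∇ 0₃ 2₃ = refl
  offset-∇ 1₃ 0₃ = refl
  offset-∇ 1₃ 1₃ = refl
  offset-∇ 1₃ 2₃ = refl
  offset-∇ 2₃ 0₃ = refl
  offset-∇ 2₃ 1₃ = refl
  offset-∇ 2₃ 2₃ = refl

  private
    affine-∇ : ∀ s t p q {u₀ v₀ w₀ u₁ v₁ w₁ u v w} → u ≡ - u₀ - u₁ → v ≡ - v₀ - v₁ → w ≡ - w₀ - (t * v₁ + w₁) - s * u →
               (s + p) * u + q * v + w ≡ - (p * u₀ + q * v₀ + w₀) - (p * u₁ + (t + q) * v₁ + w₁)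
    affine-∇ s t p q {u₀} {v₀} {w₀} {u₁} {v₁} {w₁} refl refl refl = identity s t p q u₀ v₀ w₀ u₁ v₁ w₁
      where
      identity : ∀ s t p q u₀ v₀ w₀ u₁ v₁ w₁ →
                 (s + p) * (- u₀ - u₁) + q * (- v₀ - v₁) + (- w₀ - (t * v₁ + w₁) - s * (- u₀ - u₁)) ≡ - (p * u₀ + q * v₀ + w₀) - (p * u₁ + (t + q) * v₁ + w₁)
      identity = solve-∀

  Ψ₂-∇ : Satisfies∇ Ψ₂
  Ψ₂-∇ i j with divMod3 i | divMod3 j
  ... | p , α | q , β rewrite -₃suc₃ β α | suc₃-₃ β α =
    affine-∇ (+ carry α) (+ carry β) (+ p) (+ q) (columnStep-∇ (β -₃ α)) (rowStep-∇ (β -₃ α)) (offset-∇ α β)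

  H-sucʳ : ∀ x y → H x (suc (proj₁ y) , proj₂ y) ≡ H x y + rowStep (proj₂ y -₃ proj₂ x)
  H-sucʳ (p , α) (q , β) = identity (+ p) (+ q) (columnStep (β -₃ α)) (rowStep (β -₃ α)) (offset α β)
    where
    identity : ∀ p q u v w → p * u + (+ 1 + q) * v + w ≡ p * u + q * v + w + v
    identity = solve-∀

  H-sucˡ : ∀ x y → H (suc (proj₁ x) , proj₂ x) y ≡ H x y + columnStep (proj₂ y -₃ proj₂ x)
  H-sucˡ (p , α) (q , β) = identity (+ p) (+ q) (columnStep (β -₃ α)) (rowStep (β -₃ α)) (offset α β)
    where
    identity : ∀ p q u v w → (+ 1 + p) * u + q * v + w ≡ p * u + q * v + w + u
    identity = solve-∀

  Ψ₂-+3ʳ : ∀ i j → Ψ₂ i (3 ℕ.+ j) ≡ Ψ₂ i j + rowStep (class i j)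
  Ψ₂-+3ʳ i j = trans (cong (H (divMod3 i)) (divMod3-+3 j)) (H-sucʳ (divMod3 i) (divMod3 j))

  Ψ₂-+3ˡ : ∀ i j → Ψ₂ (3 ℕ.+ i) j ≡ Ψ₂ i j + columnStep (class i j)
  Ψ₂-+3ˡ i j = trans (cong (λ x → H x (divMod3 j)) (divMod3-+3 i)) (H-sucˡ (divMod3 i) (divMod3 j))

  module _ (a₁ a₂ : ℤ) where

    Φ : ℕ → ℕ → ℤ
    Φ i j = a₁ * Ψ₁ i j + a₂ * Ψ₂ i j

    Φ-∇ : Satisfies∇ Φ
    Φ-∇ = Satisfies∇-linear a₁ a₂ Ψ₁-∇ Ψ₂-∇

    private
      Φ-step : ∀ i′ j′ i j s → Ψ₁ i′ j′ ≡ Ψ₁ i j → Ψ₂ i′ j′ ≡ Ψ₂ i j + s → Φ i′ j′ ≡ Φ i j + a₂ * s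
      Φ-step _ _ i j s Ψ₁≡ Ψ₂≡ rewrite Ψ₁≡ | Ψ₂≡ = identity a₁ a₂ (Ψ₁ i j) (Ψ₂ i j) s
        where
        identity : ∀ a₁ a₂ x y s → a₁ * x + a₂ * (y + s) ≡ a₁ * x + a₂ * y + a₂ * s
        identity = solve-∀

    Φ-+3ʳ : ∀ i j → Φ i (3 ℕ.+ j) ≡ Φ i j + a₂ * rowStep (class i j)
    Φ-+3ʳ i j = Φ-step i (3 ℕ.+ j) i j (rowStep (class i j)) (cong A₁-pattern (class-+3ʳ i j)) (Ψ₂-+3ʳ i j)

    Φ-+3ˡ : ∀ i j → Φ (3 ℕ.+ i) j ≡ Φ i j + a₂ * columnStep (class i j)
    Φ-+3ˡ i j = Φ-step (3 ℕ.+ i) j i j (columnStep (class i j)) (cong A₁-pattern (class-+3ˡ i j)) (Ψ₂-+3ˡ i j)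

    Φ-+3-antidiagonal : ∀ i j → Φ (3 ℕ.+ i) j ≡ Φ i (3 ℕ.+ j) + a₂ * antidiagonalStep (class i j)
    Φ-+3-antidiagonal i j = begin
      Φ (3 ℕ.+ i) j                                                  ≡⟨ Φ-+3ˡ i j ⟩
      Φ i j + a₂ * columnStep c                                      ≡⟨ identity (Φ i j) a₂ (rowStep c) (columnStep c) ⟩
      Φ i j + a₂ * rowStep c + a₂ * antidiagonalStep c                   ≡⟨ cong (_+ a₂ * antidiagonalStep c) (Φ-+3ʳ i j) ⟨
      Φ i (3 ℕ.+ j) + a₂ * antidiagonalStep c                            ∎
      where
      open ≡-Reasoning
      c : Residue3
      c = class i j
      identity : ∀ x a r s → x + a * s ≡ x + a * r + a * (s - r)
      identity = solve-∀

module QuasiPeriodic where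

  open import Data.Nat as ℕ using (ℕ; zero; suc; NonZero; _<_; _≟_)
  import Data.Nat.Properties as ℕ
  import Data.Nat.Tactic.RingSolver as ℕ-Solver
  open import Data.Integer using (ℤ; +_; _+_; _*_)
  open import Data.Integer.DivMod using (_%ℕ_)
  open import Data.Integer.Tactic.RingSolver using (solve-∀)
  open import Relation.Binary.PropositionalEquality
  open FiniteSums
  open Congruence
  open ArithmeticProgressions

  module _ {k n : ℕ} {φ e : ℕ → ℤ}
    (φ-step : ∀ x → x ℕ.+ k < n → φ (x ℕ.+ k) ≡ φ x + e x)
    (e-periodic : ∀ x → x ℕ.+ k < n → e (x ℕ.+ k) ≡ e x)
    where

    private
      next : ∀ c q → c ℕ.+ suc q ℕ.* k ≡ (c ℕ.+ q ℕ.* k) ℕ.+ k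
      next c q = trans (cong (c ℕ.+_) (ℕ.+-comm k (q ℕ.* k))) (sym (ℕ.+-assoc c (q ℕ.* k) k))

      previous< : ∀ c q → c ℕ.+ suc q ℕ.* k < n → (c ℕ.+ q ℕ.* k) ℕ.+ k < n
      previous< c q = subst (_< n) (next c q)

      smaller< : ∀ c q → c ℕ.+ suc q ℕ.* k < n → c ℕ.+ q ℕ.* k < n
      smaller< c q bound = ℕ.≤-<-trans (ℕ.m≤m+n _ k) (previous< c q bound)

    e-periodic-iterate : ∀ c q → c ℕ.+ q ℕ.* k < n → e (c ℕ.+ q ℕ.* k) ≡ e c
    e-periodic-iterate c zero    _     = cong e (ℕ.+-identityʳ c)
    e-periodic-iterate c (suc q) bound = begin
      e (c ℕ.+ suc q ℕ.* k)          ≡⟨ cong e (next c q) ⟩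
      e ((c ℕ.+ q ℕ.* k) ℕ.+ k)      ≡⟨ e-periodic _ (previous< c q bound) ⟩
      e (c ℕ.+ q ℕ.* k)              ≡⟨ e-periodic-iterate c q (smaller< c q bound) ⟩
      e c                            ∎
      where open ≡-Reasoning

    φ-iterate : ∀ c q → c ℕ.+ q ℕ.* k < n → φ (c ℕ.+ q ℕ.* k) ≡ φ c + + q * e c
    φ-iterate c zero    _     = trans (cong φ (ℕ.+-identityʳ c)) (sym (identity (φ c) (e c)))
      where
      identity : ∀ x e → x + + 0 * e ≡ x
      identity = solve-∀
    φ-iterate c (suc q) bound = begin
      φ (c ℕ.+ suc q ℕ.* k)                          ≡⟨ cong φ (next c q) ⟩
      φ ((c ℕ.+ q ℕ.* k) ℕ.+ k)                      ≡⟨ φ-step _ (previous< c q bound) ⟩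
      φ (c ℕ.+ q ℕ.* k) + e (c ℕ.+ q ℕ.* k)          ≡⟨ cong₂ _+_ (φ-iterate c q (smaller< c q bound)) (e-periodic-iterate c q (smaller< c q bound)) ⟩
      φ c + + q * e c + e c                          ≡⟨ identity (φ c) (+ q) (e c) ⟩
      φ c + + suc q * e c                            ∎
      where
      open ≡-Reasoning
      identity : ∀ x q e → x + q * e + e ≡ x + (+ 1 + q) * e
      identity = solve-∀

  -- φ interleaves k arithmetic progressions, and each of them is m-periodic modulo m.
  count-quasiperiodic : ∀ (m : ℕ) .{{_ : NonZero m}} k l {φ e : ℕ → ℤ} →
    (∀ x → x ℕ.+ k < k ℕ.* l ℕ.* m → φ (x ℕ.+ k) ≡ φ x + e x) →
    (∀ x → x ℕ.+ k < k ℕ.* l ℕ.* m → e (x ℕ.+ k) ≡ e x) →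
    ∀ r → ∑ (k ℕ.* l ℕ.* m) (λ x → ⟦ φ x %ℕ m ≟ r ⟧) ≡ l ℕ.* ∑ k (λ c → countAP m (φ c) (e c) r)
  count-quasiperiodic m k l {φ} {e} φ-step e-periodic r = begin
    ∑ (k ℕ.* l ℕ.* m) (λ x → ⟦ φ x %ℕ m ≟ r ⟧)                                     ≡⟨ cong (λ n → ∑ n (λ x → ⟦ φ x %ℕ m ≟ r ⟧)) n≡lm*k ⟩
    ∑ (l ℕ.* m ℕ.* k) (λ x → ⟦ φ x %ℕ m ≟ r ⟧)                                     ≡⟨ ∑-residues (l ℕ.* m) k (λ x → ⟦ φ x %ℕ m ≟ r ⟧) ⟩
    ∑ k (λ c → ∑ (l ℕ.* m) (λ q → ⟦ φ (c ℕ.+ q ℕ.* k) %ℕ m ≟ r ⟧))                 ≡⟨ ∑-cong k (λ c c<k → ∑-cong (l ℕ.* m) (λ q q<lm → cong (λ z → ⟦ z %ℕ m ≟ r ⟧) (φ-iterate {φ = φ} {e} φ-step e-periodic c q (bound c<k q<lm)))) ⟩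
    ∑ k (λ c → ∑ (l ℕ.* m) (λ q → ⟦ (φ c + + q * e c) %ℕ m ≟ r ⟧))                 ≡⟨ ∑-cong-≗ k (λ c → ∑-periodic m _ (periodic c) l) ⟩
    ∑ k (λ c → l ℕ.* countAP m (φ c) (e c) r)                                      ≡⟨ ∑-*ˡ l k (λ c → countAP m (φ c) (e c) r) ⟩
    l ℕ.* ∑ k (λ c → countAP m (φ c) (e c) r)                                      ∎
    where
    open ≡-Reasoning
    n≡lm*k : k ℕ.* l ℕ.* m ≡ l ℕ.* m ℕ.* k
    n≡lm*k = commute k l m
      where
      commute : ∀ k l m → k ℕ.* l ℕ.* m ≡ l ℕ.* m ℕ.* k
      commute = ℕ-Solver.solve-∀
    bound : ∀ {c q} → c < k → q < l ℕ.* m → c ℕ.+ q ℕ.* k < k ℕ.* l ℕ.* m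
    bound {c} {q} c<k q<lm = subst (c ℕ.+ q ℕ.* k <_) (sym n≡lm*k) (ℕ.<-≤-trans (ℕ.+-monoˡ-< (q ℕ.* k) c<k) (ℕ.*-monoˡ-≤ k q<lm))
    periodic : ∀ c q → ⟦ (φ c + + (m ℕ.+ q) * e c) %ℕ m ≟ r ⟧ ≡ ⟦ (φ c + + q * e c) %ℕ m ≟ r ⟧
    periodic c q = cong (λ z → ⟦ z ≟ r ⟧) (≡mod⇒%ℕ-≡ m {y = φ c + + q * e c} (congruent (e c) (identity (φ c) (+ m) (+ q) (e c))))
      where
      identity : ∀ x m q e → x + (m + q) * e ≡ x + q * e + e * m
      identity = solve-∀

module LineCounts where

  open import Data.Nat as ℕ using (ℕ; suc; NonZero; _<_; _%_; _≟_; z≤n; s≤s)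
  import Data.Nat.Properties as ℕ
  open import Data.Nat.DivMod using (n%1≡0; m%n<n)
  open import Data.Nat.GCD using (gcd)
  import Data.Nat.Tactic.RingSolver as ℕ-Solver
  open import Data.Integer.Tactic.RingSolver using (solve-∀)
  open import Data.Integer using (ℤ; +_; _+_; _*_; ∣_∣)
  open import Data.Integer.DivMod using (_%ℕ_; n%ℕd<d)
  open import Data.Sum using (_⊎_; inj₁; inj₂)
  open import Relation.Binary.PropositionalEquality
  open import Relation.Nullary using (contradiction)
  open FiniteSums
  open Congruence
  open Units
  open ArithmeticProgressions
  open ClosedForm

  ∑₃ : (Residue3 → ℕ) → ℕ
  ∑₃ Z = Z 0₃ ℕ.+ Z 1₃ ℕ.+ Z 2₃

  ∑₃-cong : ∀ {Z Z′} → (∀ ρ → Z ρ ≡ Z′ ρ) → ∑₃ Z ≡ ∑₃ Z′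
  ∑₃-cong Z≗Z′ = cong₂ ℕ._+_ (cong₂ ℕ._+_ (Z≗Z′ 0₃) (Z≗Z′ 1₃)) (Z≗Z′ 2₃)

  Rotating : (ℕ → Residue3) → Set
  Rotating κ = (∀ c → c < 2 → κ (suc c) ≡ suc₃ (κ c)) ⊎ (∀ c → c < 2 → κ (suc c) ≡ pred₃ (κ c))

  ∑-Rotating : ∀ (Z : Residue3 → ℕ) {κ} → Rotating κ → ∑ 3 (λ c → Z (κ c)) ≡ ∑₃ Z
  ∑-Rotating Z {κ} (inj₁ up) = trans (cong₂ (λ ρ₁ ρ₂ → Z (κ 0) ℕ.+ Z ρ₁ ℕ.+ Z ρ₂) (up 0 (s≤s z≤n)) (trans (up 1 (s≤s (s≤s z≤n))) (cong suc₃ (up 0 (s≤s z≤n))))) (orbit (κ 0))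
    where
    orbit : ∀ ρ → Z ρ ℕ.+ Z (suc₃ ρ) ℕ.+ Z (suc₃ (suc₃ ρ)) ≡ ∑₃ Z
    orbit 0₃ = refl
    orbit 1₃ = rotate (Z 0₃) (Z 1₃) (Z 2₃)
      where
      rotate : ∀ x y z → y ℕ.+ z ℕ.+ x ≡ x ℕ.+ y ℕ.+ z
      rotate = ℕ-Solver.solve-∀
    orbit 2₃ = rotate (Z 0₃) (Z 1₃) (Z 2₃)
      where
      rotate : ∀ x y z → z ℕ.+ x ℕ.+ y ≡ x ℕ.+ y ℕ.+ z
      rotate = ℕ-Solver.solve-∀
  ∑-Rotating Z {κ} (inj₂ down) = trans (cong₂ (λ ρ₁ ρ₂ → Z (κ 0) ℕ.+ Z ρ₁ ℕ.+ Z ρ₂) (down 0 (s≤s z≤n)) (trans (down 1 (s≤s (s≤s z≤n))) (cong pred₃ (down 0 (s≤s z≤n))))) (orbit (κ 0))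
    where
    orbit : ∀ ρ → Z ρ ℕ.+ Z (pred₃ ρ) ℕ.+ Z (pred₃ (pred₃ ρ)) ≡ ∑₃ Z
    orbit 0₃ = reflect (Z 0₃) (Z 1₃) (Z 2₃)
      where
      reflect : ∀ x y z → x ℕ.+ z ℕ.+ y ≡ x ℕ.+ y ℕ.+ z
      reflect = ℕ-Solver.solve-∀
    orbit 1₃ = reflect (Z 0₃) (Z 1₃) (Z 2₃)
      where
      reflect : ∀ x y z → y ℕ.+ x ℕ.+ z ≡ x ℕ.+ y ℕ.+ z
      reflect = ℕ-Solver.solve-∀
    orbit 2₃ = reflect (Z 0₃) (Z 1₃) (Z 2₃)
      where
      reflect : ∀ x y z → z ℕ.+ y ℕ.+ x ≡ x ℕ.+ y ℕ.+ z
      reflect = ℕ-Solver.solve-∀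

  -- a·A₁-pattern takes the values a, 0, -a, a complete residue system modulo 3 when 3 ∤ a.
  A₁-pattern-residues : ∀ a → a %ℕ 3 ≢ 0 → ∀ s → s < 3 → ∑₃ (λ ρ → ⟦ (a * A₁-pattern ρ) %ℕ 3 ≟ s ⟧) ≡ 1
  A₁-pattern-residues a a≢0 s s<3 = trans (∑₃-cong reduce) (table (a %ℕ 3) (n%ℕd<d a 3) a≢0 s s<3)
    where
    reduce : ∀ ρ → ⟦ (a * A₁-pattern ρ) %ℕ 3 ≟ s ⟧ ≡ ⟦ (+ (a %ℕ 3) * A₁-pattern ρ) %ℕ 3 ≟ s ⟧
    reduce ρ = cong (λ x → ⟦ x ≟ s ⟧) (≡mod⇒%ℕ-≡ 3 (≡mod-*ʳ (A₁-pattern ρ) (≡mod-sym (%ℕ-≡mod 3 a))))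
    table : ∀ α → α < 3 → α ≢ 0 → ∀ s → s < 3 → ∑₃ (λ ρ → ⟦ (+ α * A₁-pattern ρ) %ℕ 3 ≟ s ⟧) ≡ 1
    table 0 _ α≢0 _ _ = contradiction refl α≢0
    table 1 _ _ 0 _ = refl
    table 1 _ _ 1 _ = refl
    table 1 _ _ 2 _ = refl
    table 2 _ _ 0 _ = refl
    table 2 _ _ 1 _ = refl
    table 2 _ _ 2 _ = refl
    table (suc (suc (suc _))) (s≤s (s≤s (s≤s ()))) _ _ _
    table (suc _) _ _ (suc (suc (suc _))) (s≤s (s≤s (s≤s ())))

  module _ {m : ℕ} (m-odd : m % 2 ≡ 1) where

    rowStep-invertible : ∀ c → Invertible (+ m) (rowStep c)
    rowStep-invertible 0₃ = invertible-neg 1-invertible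
    rowStep-invertible 1₃ = 2-invertible m m-odd
    rowStep-invertible 2₃ = invertible-neg 1-invertible

    columnStep-invertible : ∀ c → Invertible (+ m) (columnStep c)
    columnStep-invertible 0₃ = 1-invertible
    columnStep-invertible 1₃ = 1-invertible
    columnStep-invertible 2₃ = invertible-neg (2-invertible m m-odd)

    antidiagonalStep-invertible : ∀ c → Invertible (+ m) (antidiagonalStep c)
    antidiagonalStep-invertible 0₃ = 2-invertible m m-odd
    antidiagonalStep-invertible 1₃ = invertible-neg 1-invertible
    antidiagonalStep-invertible 2₃ = invertible-neg 1-invertible

  -- For d = 1 each progression hits r once; for d = 3 only the one starting ≡ r modulo 3 does, three times.
  ∑-countAP-rotating : ∀ a₁ a₂ (m : ℕ) .{{_ : NonZero m}} {d} → ScaledUnit m d a₂ → gcd ∣ a₁ ∣ d ≡ 1 → d ≡ 1 ⊎ d ≡ 3 →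
    ∀ {κ : ℕ → Residue3} {step : Residue3 → ℤ} (h : ℕ → ℤ) → Rotating κ → (∀ c → Invertible (+ m) (step c)) →
    ∀ {r} → r < m → ∑ 3 (λ c → countAP m (a₁ * A₁-pattern (κ c) + a₂ * h c) (a₂ * step (κ c)) r) ≡ 3
  ∑-countAP-rotating a₁ a₂ m a₂-scaled _ (inj₁ refl) {κ} {step} h _ step-invertible {r} r<m =
    ∑-cong 3 (λ c _ → trans (countAP-ScaledUnit m (ScaledUnit-*-invertible a₂-scaled (step-invertible (κ c))) (x c) r<m) (cong (1 ℕ.*_) (⟦yes⟧ (x c %ℕ 1 ≟ r % 1) (residues-mod-1 (x c)))))
    where
    x : ℕ → ℤ
    x c = a₁ * A₁-pattern (κ c) + a₂ * h c
    residues-mod-1 : ∀ x → x %ℕ 1 ≡ r % 1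
    residues-mod-1 x = trans (ℕ.n<1⇒n≡0 (n%ℕd<d x 1)) (sym (n%1≡0 r))
  ∑-countAP-rotating a₁ a₂ m a₂-scaled gcd≡1 (inj₂ refl) {κ} {step} h rotating step-invertible {r} r<m = begin
    ∑ 3 (λ c → countAP m (x c) (a₂ * step (κ c)) r)             ≡⟨ ∑-cong 3 (λ c _ → countAP-ScaledUnit m (ScaledUnit-*-invertible a₂-scaled (step-invertible (κ c))) (x c) r<m) ⟩
    ∑ 3 (λ c → 3 ℕ.* ⟦ x c %ℕ 3 ≟ r % 3 ⟧)                      ≡⟨ ∑-cong-≗ 3 (λ c → cong (λ y → 3 ℕ.* ⟦ y ≟ r % 3 ⟧) (x≡a₁-pattern c)) ⟩
    ∑ 3 (λ c → 3 ℕ.* Z (κ c))                                   ≡⟨ ∑-*ˡ 3 3 (λ c → Z (κ c)) ⟩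
    3 ℕ.* ∑ 3 (λ c → Z (κ c))                                   ≡⟨ cong (3 ℕ.*_) (∑-Rotating Z rotating) ⟩
    3 ℕ.* ∑₃ Z                                                  ≡⟨ cong (3 ℕ.*_) (A₁-pattern-residues a₁ (gcd≡1⇒%ℕ≢0 a₁ 3 gcd≡1 (λ ())) (r % 3) (m%n<n r 3)) ⟩
    3                                                           ∎
    where
    open ≡-Reasoning
    open ScaledUnit a₂-scaled using (unit; e≡d*unit)
    x : ℕ → ℤ
    x c = a₁ * A₁-pattern (κ c) + a₂ * h c
    Z : Residue3 → ℕ
    Z ρ = ⟦ (a₁ * A₁-pattern ρ) %ℕ 3 ≟ r % 3 ⟧
    x≡a₁-pattern : ∀ c → x c %ℕ 3 ≡ (a₁ * A₁-pattern (κ c)) %ℕ 3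
    x≡a₁-pattern c = ≡mod⇒%ℕ-≡ 3 {x c} {a₁ * A₁-pattern (κ c)} (congruent (unit * h c) (trans (cong (λ a → a₁ * A₁-pattern (κ c) + a * h c) e≡d*unit) (identity (a₁ * A₁-pattern (κ c)) unit (h c))))
      where
      identity : ∀ y u h → y + + 3 * u * h ≡ y + u * h * + 3
      identity = solve-∀

module TriangleLines where

  open import Data.Nat as ℕ using (ℕ; suc; NonZero; _<_; _≤_; _∸_; _%_; _≟_)
  import Data.Nat.Properties as ℕ
  import Data.Nat.Tactic.RingSolver as ℕ-Solver
  open import Data.Nat.GCD using (gcd)
  open import Data.Integer using (ℤ; _+_; _*_; ∣_∣)
  open import Data.Integer.DivMod using (_%ℕ_)
  open import Data.Sum using (_⊎_; inj₁; inj₂)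
  open import Relation.Binary.PropositionalEquality
  open FiniteSums
  open Units
  open ClosedForm
  open QuasiPeriodic
  open LineCounts

  private
    shift : ∀ j x k → j ℕ.+ (x ℕ.+ k) ≡ k ℕ.+ (j ℕ.+ x)
    shift = ℕ-Solver.solve-∀

    2≤L : ∀ {L} l {m} .{{_ : NonZero m}} → suc L ≡ 3 ℕ.* l ℕ.* m → 2 ≤ L
    2≤L (suc l) {m} 1+L≡3lm = ℕ.≤-pred (subst (3 ≤_) (sym 1+L≡3lm) (ℕ.≤-trans (ℕ.m≤m*n 3 (suc l)) (ℕ.m≤m*n (3 ℕ.* suc l) m)))

    +-left-comm : ∀ j k y → j ℕ.+ (k ℕ.+ y) ≡ k ℕ.+ (j ℕ.+ y)
    +-left-comm = ℕ-Solver.solve-∀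

    ∸-split : ∀ {L x} k → x ℕ.+ k ≤ L → L ∸ x ≡ k ℕ.+ (L ∸ (x ℕ.+ k))
    ∸-split {L} {x} k x+k≤L = begin
      L ∸ x                     ≡⟨ ℕ.m+[n∸m]≡n k≤L∸x ⟨
      k ℕ.+ (L ∸ x ∸ k)         ≡⟨ cong (k ℕ.+_) (ℕ.∸-+-assoc L x k) ⟩
      k ℕ.+ (L ∸ (x ℕ.+ k))     ∎
      where
      open ≡-Reasoning
      k≤L∸x : k ≤ L ∸ x
      k≤L∸x = subst (_≤ L ∸ x) (ℕ.m+n∸m≡n x k) (ℕ.∸-monoˡ-≤ x x+k≤L)

    pred₃≡suc₃² : ∀ ρ → pred₃ ρ ≡ suc₃ (suc₃ ρ)
    pred₃≡suc₃² 0₃ = refl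
    pred₃≡suc₃² 1₃ = refl
    pred₃≡suc₃² 2₃ = refl

  module Counts (a₁ a₂ : ℤ) (m : ℕ) .{{_ : NonZero m}} (m-odd : m % 2 ≡ 1) {d}
    (a₂-scaled : ScaledUnit m d a₂) (gcd≡1 : gcd ∣ a₁ ∣ d ≡ 1) (d≡1⊎d≡3 : d ≡ 1 ⊎ d ≡ 3) where

    row-count : ∀ i j l {r} → r < m → ∑ (3 ℕ.* l ℕ.* m) (λ x → ⟦ Φ a₁ a₂ i (j ℕ.+ x) %ℕ m ≟ r ⟧) ≡ l ℕ.* 3
    row-count i j l {r} r<m = trans
      (count-quasiperiodic m 3 l {λ x → Φ a₁ a₂ i (j ℕ.+ x)} {λ x → a₂ * rowStep (class i (j ℕ.+ x))} (λ x _ → trans (cong (Φ a₁ a₂ i) (shift j x 3)) (Φ-+3ʳ a₁ a₂ i (j ℕ.+ x))) (λ x _ → cong (λ c → a₂ * rowStep c) (class-step x)) r)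
      (cong (l ℕ.*_) (∑-countAP-rotating a₁ a₂ m a₂-scaled gcd≡1 d≡1⊎d≡3 (λ c → Ψ₂ i (j ℕ.+ c)) rotating (rowStep-invertible m-odd) r<m))
      where
      class-step : ∀ x → class i (j ℕ.+ (x ℕ.+ 3)) ≡ class i (j ℕ.+ x)
      class-step x = trans (cong (class i) (shift j x 3)) (class-+3ʳ i (j ℕ.+ x))
      rotating : Rotating (λ c → class i (j ℕ.+ c))
      rotating = inj₁ (λ c _ → trans (cong (class i) (ℕ.+-suc j c)) (class-sucʳ i (j ℕ.+ c)))

    column-count : ∀ i j l {r} → r < m → ∑ (3 ℕ.* l ℕ.* m) (λ x → ⟦ Φ a₁ a₂ (i ℕ.+ x) j %ℕ m ≟ r ⟧) ≡ l ℕ.* 3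
    column-count i j l {r} r<m = trans
      (count-quasiperiodic m 3 l {λ x → Φ a₁ a₂ (i ℕ.+ x) j} {λ x → a₂ * columnStep (class (i ℕ.+ x) j)} (λ x _ → trans (cong (λ i′ → Φ a₁ a₂ i′ j) (shift i x 3)) (Φ-+3ˡ a₁ a₂ (i ℕ.+ x) j)) (λ x _ → cong (λ c → a₂ * columnStep c) (class-step x)) r)
      (cong (l ℕ.*_) (∑-countAP-rotating a₁ a₂ m a₂-scaled gcd≡1 d≡1⊎d≡3 (λ c → Ψ₂ (i ℕ.+ c) j) rotating (columnStep-invertible m-odd) r<m))
      where
      class-step : ∀ x → class (i ℕ.+ (x ℕ.+ 3)) j ≡ class (i ℕ.+ x) j
      class-step x = trans (cong (λ i′ → class i′ j) (shift i x 3)) (class-+3ˡ (i ℕ.+ x) j)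
      rotating : Rotating (λ c → class (i ℕ.+ c) j)
      rotating = inj₂ (λ c _ → trans (cong (λ i′ → class i′ j) (ℕ.+-suc i c)) (class-sucˡ (i ℕ.+ c) j))

    antidiagonal-count : ∀ i j L l {r} → r < m → suc L ≡ 3 ℕ.* l ℕ.* m →
      ∑ (suc L) (λ x → ⟦ Φ a₁ a₂ (i ℕ.+ x) (j ℕ.+ (L ∸ x)) %ℕ m ≟ r ⟧) ≡ l ℕ.* 3
    antidiagonal-count i j L l {r} r<m 1+L≡3lm = begin
      ∑ (suc L) (λ x → ⟦ φ x %ℕ m ≟ r ⟧)               ≡⟨ cong (λ n → ∑ n (λ x → ⟦ φ x %ℕ m ≟ r ⟧)) 1+L≡3lm ⟩
      ∑ (3 ℕ.* l ℕ.* m) (λ x → ⟦ φ x %ℕ m ≟ r ⟧)       ≡⟨ count-quasiperiodic m 3 l {φ} {e} (λ x lt → φ-step x (below lt)) (λ x lt → cong (λ c → a₂ * antidiagonalStep c) (κ-step x (below lt))) r ⟩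
      l ℕ.* ∑ 3 (λ c → countAP′ c)                     ≡⟨ cong (l ℕ.*_) (∑-countAP-rotating a₁ a₂ m a₂-scaled gcd≡1 d≡1⊎d≡3 (λ c → Ψ₂ (i ℕ.+ c) (column c)) rotating (antidiagonalStep-invertible m-odd) r<m) ⟩
      l ℕ.* 3                                          ∎
      where
      open ≡-Reasoning
      column : ℕ → ℕ
      column x = j ℕ.+ (L ∸ x)
      κ : ℕ → Residue3
      κ x = class (i ℕ.+ x) (column x)
      φ : ℕ → ℤ
      φ x = Φ a₁ a₂ (i ℕ.+ x) (column x)
      e : ℕ → ℤ
      e x = a₂ * antidiagonalStep (κ x)
      countAP′ : ℕ → ℕ
      countAP′ c = ArithmeticProgressions.countAP m (φ c) (e c) r

      below : ∀ {x} → x ℕ.+ 3 < 3 ℕ.* l ℕ.* m → x ℕ.+ 3 ≤ L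
      below {x} lt = ℕ.≤-pred (subst (x ℕ.+ 3 <_) (sym 1+L≡3lm) lt)

      column-split : ∀ {x} k → x ℕ.+ k ≤ L → column x ≡ k ℕ.+ column (x ℕ.+ k)
      column-split {x} k le = trans (cong (j ℕ.+_) (∸-split k le)) (+-left-comm j k (L ∸ (x ℕ.+ k)))

      class-split : ∀ {x} → x ℕ.+ 3 ≤ L → class (i ℕ.+ x) (column (x ℕ.+ 3)) ≡ κ x
      class-split {x} le = sym (trans (cong (class (i ℕ.+ x)) (column-split 3 le)) (class-+3ʳ (i ℕ.+ x) (column (x ℕ.+ 3))))

      φ-step : ∀ x → x ℕ.+ 3 ≤ L → φ (x ℕ.+ 3) ≡ φ x + e x
      φ-step x le = begin
        Φ a₁ a₂ (i ℕ.+ (x ℕ.+ 3)) (column (x ℕ.+ 3))                                          ≡⟨ cong (λ i′ → Φ a₁ a₂ i′ (column (x ℕ.+ 3))) (shift i x 3) ⟩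
        Φ a₁ a₂ (3 ℕ.+ (i ℕ.+ x)) (column (x ℕ.+ 3))                                          ≡⟨ Φ-+3-antidiagonal a₁ a₂ (i ℕ.+ x) (column (x ℕ.+ 3)) ⟩
        Φ a₁ a₂ (i ℕ.+ x) (3 ℕ.+ column (x ℕ.+ 3)) + a₂ * antidiagonalStep (class (i ℕ.+ x) (column (x ℕ.+ 3))) ≡⟨ cong₂ (λ y c → Φ a₁ a₂ (i ℕ.+ x) y + a₂ * antidiagonalStep c) (sym (column-split 3 le)) (class-split le) ⟩
        φ x + e x                                                                        ∎

      κ-step : ∀ x → x ℕ.+ 3 ≤ L → κ (x ℕ.+ 3) ≡ κ x
      κ-step x le = trans (cong (λ i′ → class i′ (column (x ℕ.+ 3))) (shift i x 3)) (trans (class-+3ˡ (i ℕ.+ x) (column (x ℕ.+ 3))) (class-split le))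

      rotating : Rotating κ
      rotating = inj₁ λ c c<2 → begin
        class (i ℕ.+ suc c) (column (suc c))           ≡⟨ cong (λ i′ → class i′ (column (suc c))) (ℕ.+-suc i c) ⟩
        class (suc (i ℕ.+ c)) (column (suc c))         ≡⟨ class-sucˡ (i ℕ.+ c) (column (suc c)) ⟩
        pred₃ (class (i ℕ.+ c) (column (suc c)))       ≡⟨ pred₃≡suc₃² _ ⟩
        suc₃ (suc₃ (class (i ℕ.+ c) (column (suc c)))) ≡⟨ cong suc₃ (class-sucʳ (i ℕ.+ c) (column (suc c))) ⟨
        suc₃ (class (i ℕ.+ c) (suc (column (suc c))))  ≡⟨ cong (λ y → suc₃ (class (i ℕ.+ c) y)) (column-suc c c<2) ⟨
        suc₃ (κ c)                                     ∎
        where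
        column-suc : ∀ c → c < 2 → column c ≡ suc (column (suc c))
        column-suc c c<2 = trans (column-split 1 (subst (_≤ L) (ℕ.+-comm 1 c) (ℕ.≤-trans c<2 (2≤L l 1+L≡3lm)))) (cong (λ x → suc (column x)) (ℕ.+-comm c 1))

module Sequence where

  open import Data.Nat as ℕ using (ℕ; zero; suc; NonZero; _≤_; _∸_)
  import Data.Nat.Properties as ℕ
  import Data.Nat.DivMod as ℕ
  open import Data.Integer as ℤ using (ℤ; +_; _+_; _*_)
  open import Data.Integer.Properties using (*-zeroʳ; *-identityʳ; +-identityʳ; +-identityˡ; *-distribˡ-+; pos-*)
  open import Data.Integer.DivMod using (_%ℕ_)
  open import Data.Integer.Tactic.RingSolver using (solve-∀)
  open import Data.Fin as Fin using (Fin; toℕ; opposite)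
  open import Data.Fin.Properties using (opposite-prop; toℕ<n; toℕ-fromℕ<; all?)
  open import Data.List using (foldr; tabulate)
  open import Data.List.Properties using (map-tabulate; tabulate-cong)
  open import Data.Bool using (if_then_else_)
  open import Data.Product using (_×_; _,_)
  open import Function using (_∘_; mk⇔)
  open import Relation.Binary.PropositionalEquality
  open import Relation.Nullary.Decidable using (does-⇔; from-yes; _×-dec_)
  open import Defs
  open FiniteSums
  open Congruence
  open ClosedForm
  open QuasiPeriodic

  private
    ∑Fin : ∀ n → (Fin n → ℤ) → ℤ
    ∑Fin n f = foldr _+_ (+ 0) (tabulate f)

    ∑Fin-+ : ∀ n f g → ∑Fin n (λ r → f r + g r) ≡ ∑Fin n f + ∑Fin n g
    ∑Fin-+ zero    f g = refl
    ∑Fin-+ (suc n) f g = trans (cong (_+_ (f Fin.zero + g Fin.zero)) (∑Fin-+ n (f ∘ Fin.suc) (g ∘ Fin.suc))) (identity (f Fin.zero) (g Fin.zero) _ _)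
      where
      identity : ∀ a b c d → a + b + (c + d) ≡ a + c + (b + d)
      identity = solve-∀

    ∑Fin-*0 : ∀ n (v : Fin n → ℤ) → ∑Fin n (λ r → v r * + 0) ≡ + 0
    ∑Fin-*0 zero    v = refl
    ∑Fin-*0 (suc n) v = cong₂ _+_ (*-zeroʳ (v Fin.zero)) (∑Fin-*0 n (v ∘ Fin.suc))

    ∑Fin-δ : ∀ n (v : Fin n → ℤ) t → ∑Fin n (λ r → v r * δ (toℕ r) (toℕ t)) ≡ v t
    ∑Fin-δ (suc n) v Fin.zero    = trans (cong₂ _+_ (*-identityʳ (v Fin.zero)) (∑Fin-*0 n (v ∘ Fin.suc))) (+-identityʳ (v Fin.zero))
    ∑Fin-δ (suc n) v (Fin.suc t) = trans (cong₂ _+_ (*-zeroʳ (v Fin.zero)) (∑Fin-δ n (v ∘ Fin.suc) t)) (+-identityˡ (v (Fin.suc t)))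

    δ-+ : ∀ a b c → b ≤ c → δ (a ℕ.+ b) c ≡ δ a (c ∸ b)
    δ-+ a b c b≤c = cong (if_then + 1 else + 0) (does-⇔ (mk⇔ to from) (a ℕ.+ b ℕ.≟ c) (a ℕ.≟ c ∸ b))
      where
      to : a ℕ.+ b ≡ c → a ≡ c ∸ b
      to a+b≡c = trans (sym (ℕ.m+n∸n≡m a b)) (cong (_∸ b) a+b≡c)
      from : a ≡ c ∸ b → a ℕ.+ b ≡ c
      from a≡c∸b = trans (cong (ℕ._+ b) a≡c∸b) (ℕ.m∸n+n≡m b≤c)

  tri-≡mod : ∀ {M u u′} → (∀ j → u j ≡ u′ j mod M) → ∀ i j → tri u i j ≡ tri u′ i j mod M
  tri-≡mod u≡u′ zero    j = u≡u′ j
  tri-≡mod u≡u′ (suc i) j = ≡mod-+ (≡mod-neg (tri-≡mod u≡u′ i j)) (≡mod-neg (tri-≡mod u≡u′ i (suc j)))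

  ⋆X₂₄ : ∀ (v : Tuple 24) s → (v ⋆ X₂₄) s ≡ v s + v (opposite s)
  ⋆X₂₄ v s = begin
    (v ⋆ X₂₄) s                                                                      ≡⟨ cong (foldr _+_ (+ 0)) (map-tabulate (λ r → r) (λ r → v r * X₂₄ r s)) ⟩
    ∑Fin 24 (λ r → v r * X₂₄ r s)                                                    ≡⟨ cong (foldr _+_ (+ 0)) (tabulate-cong λ r → trans (*-distribˡ-+ (v r) _ _) (cong (λ x → v r * δ (toℕ r) (toℕ s) + v r * x) (reflect r))) ⟩
    ∑Fin 24 (λ r → v r * δ (toℕ r) (toℕ s) + v r * δ (toℕ r) (toℕ (opposite s)))     ≡⟨ ∑Fin-+ 24 (λ r → v r * δ (toℕ r) (toℕ s)) (λ r → v r * δ (toℕ r) (toℕ (opposite s))) ⟩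
    ∑Fin 24 (λ r → v r * δ (toℕ r) (toℕ s)) + ∑Fin 24 (λ r → v r * δ (toℕ r) (toℕ (opposite s))) ≡⟨ cong₂ _+_ (∑Fin-δ 24 v s) (∑Fin-δ 24 v (opposite s)) ⟩
    v s + v (opposite s)                                                             ∎
    where
    open ≡-Reasoning
    reflect : ∀ r → δ (toℕ r ℕ.+ toℕ s) 23 ≡ δ (toℕ r) (toℕ (opposite s))
    reflect r = trans (δ-+ (toℕ r) (toℕ s) 23 (ℕ.≤-pred (toℕ<n s))) (cong (δ (toℕ r)) (sym (opposite-prop s)))

  A-table : ∀ (s : Fin 24) →
    Ψ₁ 0 (toℕ s) ≡ A₁ s × Ψ₂ 0 (toℕ s) ≡ A₂ s ×
    A₁ s + A₁ (opposite s) ≡ + 0 × A₂ s + A₂ (opposite s) ≡ + 8 * rowStep (class 0 (toℕ s))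
  A-table = from-yes (all? λ s →
    Ψ₁ 0 (toℕ s) ℤ.≟ A₁ s ×-dec Ψ₂ 0 (toℕ s) ℤ.≟ A₂ s ×-dec
    A₁ s + A₁ (opposite s) ℤ.≟ + 0 ×-dec A₂ s + A₂ (opposite s) ℤ.≟ + 8 * rowStep (class 0 (toℕ s)))

  module _ (a₁ a₂ : ℤ) where

    A : Tuple 24
    A = (a₁ · A₁) ⊕ (a₂ · A₂)

    Φ-row0 : ∀ (s : Fin 24) Q → Φ a₁ a₂ 0 (toℕ s ℕ.+ Q ℕ.* 24) ≡ A s + + Q * (A s + A (opposite s))
    Φ-row0 s Q with A-table s
    ... | Ψ₁≡A₁ , Ψ₂≡A₂ , A₁-antisymmetric , A₂-symmetric = begin
      Φ a₁ a₂ 0 (toℕ s ℕ.+ Q ℕ.* 24)                                            ≡⟨ cong (Φ a₁ a₂ 0) (cong (toℕ s ℕ.+_) (sym (ℕ.*-assoc Q 8 3))) ⟩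
      Φ a₁ a₂ 0 (toℕ s ℕ.+ Q ℕ.* 8 ℕ.* 3)                                       ≡⟨ φ-iterate {3} {suc (toℕ s ℕ.+ Q ℕ.* 8 ℕ.* 3)} {Φ a₁ a₂ 0} {λ j → a₂ * rowStep (class 0 j)} row-step row-periodic (toℕ s) (Q ℕ.* 8) (ℕ.n<1+n _) ⟩
      Φ a₁ a₂ 0 (toℕ s) + + (Q ℕ.* 8) * (a₂ * ρ)                                ≡⟨ cong₂ (λ x y → a₁ * x + a₂ * y + + (Q ℕ.* 8) * (a₂ * ρ)) Ψ₁≡A₁ Ψ₂≡A₂ ⟩
      A s + + (Q ℕ.* 8) * (a₂ * ρ)                                              ≡⟨ cong (λ q → A s + q * (a₂ * ρ)) (pos-* Q 8) ⟩
      A s + + Q * + 8 * (a₂ * ρ)                                                ≡⟨ identity₁ (A s) a₁ a₂ (+ Q) ρ ⟩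
      A s + + Q * (a₁ * + 0 + a₂ * (+ 8 * ρ))                                   ≡⟨ cong₂ (λ x y → A s + + Q * (a₁ * x + a₂ * y)) A₁-antisymmetric A₂-symmetric ⟨
      A s + + Q * (a₁ * (A₁ s + A₁ (opposite s)) + a₂ * (A₂ s + A₂ (opposite s))) ≡⟨ cong (λ x → A s + + Q * x) (identity₂ a₁ a₂ (A₁ s) (A₁ (opposite s)) (A₂ s) (A₂ (opposite s))) ⟩
      A s + + Q * (A s + A (opposite s))                                        ∎
      where
      open ≡-Reasoning
      ρ : ℤ
      ρ = rowStep (class 0 (toℕ s))
      row-step : ∀ j → j ℕ.+ 3 ℕ.< _ → Φ a₁ a₂ 0 (j ℕ.+ 3) ≡ Φ a₁ a₂ 0 j + a₂ * rowStep (class 0 j)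
      row-step j _ = trans (cong (Φ a₁ a₂ 0) (ℕ.+-comm j 3)) (Φ-+3ʳ a₁ a₂ 0 j)
      row-periodic : ∀ j → j ℕ.+ 3 ℕ.< _ → a₂ * rowStep (class 0 (j ℕ.+ 3)) ≡ a₂ * rowStep (class 0 j)
      row-periodic j _ = cong (λ c → a₂ * rowStep c) (trans (cong (class 0) (ℕ.+-comm j 3)) (class-+3ʳ 0 j))
      identity₁ : ∀ x a₁ a₂ q ρ → x + q * + 8 * (a₂ * ρ) ≡ x + q * (a₁ * + 0 + a₂ * (+ 8 * ρ))
      identity₁ = solve-∀
      identity₂ : ∀ a₁ a₂ x x′ y y′ → a₁ * (x + x′) + a₂ * (y + y′) ≡ a₁ * x + a₂ * y + (a₁ * x′ + a₂ * y′)
      identity₂ = solve-∀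

    module _ (m : ℕ) .{{_ : NonZero m}} where

      S : ℕ → ℤ
      S = IAP (πv m A) (πv m A ⋆ X₂₄)

      S≡Φ : ∀ j → S j ≡ Φ a₁ a₂ 0 j mod + m
      S≡Φ j = begin
        S j                                                       ≡⟨ cong (λ x → πv m A s + + Q * x) (⋆X₂₄ (πv m A) s) ⟩
        πv m A s + + Q * (πv m A s + πv m A (opposite s))         ≈⟨ ≡mod-+ (π≡ s) (≡mod-*ˡ (+ Q) (≡mod-+ (π≡ s) (π≡ (opposite s)))) ⟩
        A s + + Q * (A s + A (opposite s))                        ≡⟨ Φ-row0 s Q ⟨
        Φ a₁ a₂ 0 (toℕ s ℕ.+ Q ℕ.* 24)                            ≡⟨ cong (Φ a₁ a₂ 0) j≡s+24Q ⟨
        Φ a₁ a₂ 0 j                                               ∎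
        where
        open ≡mod-Reasoning (+ m)
        s : Fin 24
        s = j ℕ.mod 24
        Q : ℕ
        Q = j ℕ./ 24
        π≡ : ∀ t → πv m A t ≡ A t mod + m
        π≡ t = %ℕ-≡mod m (A t)
        j≡s+24Q : j ≡ toℕ s ℕ.+ Q ℕ.* 24
        j≡s+24Q = trans (ℕ.m≡m%n+[m/n]*n j 24) (cong (ℕ._+ Q ℕ.* 24) (sym (toℕ-fromℕ< (ℕ.m%n<n j 24))))

      mult≡∑△ : ∀ n (r : Fin m) → mult m S n r ≡ ∑△ n (λ i j → ⟦ Φ a₁ a₂ i j %ℕ m ℕ.≟ toℕ r ⟧)
      mult≡∑△ n r = trans (length-filter-indices _ n) (∑△-cong-≗ n (λ i j → cong (λ x → ⟦ x ℕ.≟ toℕ r ⟧) (≡mod⇒%ℕ-≡ m (tri≡Φ i j))))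
        where
        tri≡Φ : ∀ i j → tri S i j ≡ Φ a₁ a₂ i j mod + m
        tri≡Φ i j = ≡mod-trans (tri-≡mod S≡Φ i j) (≡mod-reflexive (tri-Satisfies∇ {Φ a₁ a₂} (Φ-∇ a₁ a₂) i j))

module Balance where

  open import Data.Nat
  open import Data.Nat.Properties using (*-cancelˡ-≡; m*n≢0)
  open import Data.Nat.GCD using (gcd)
  open import Data.Integer using (ℤ; ∣_∣)
  open import Data.Integer.DivMod using (_%ℕ_)
  open import Data.Sum using (_⊎_)
  open import Relation.Binary.PropositionalEquality
  open FiniteSums
  open TriangleAveraging
  open Units using (ScaledUnit)
  open ClosedForm using (Φ)

  Φ-balanced : ∀ a₁ a₂ m .{{_ : NonZero m}} → m % 2 ≡ 1 → ∀ {d} → ScaledUnit m d a₂ → gcd ∣ a₁ ∣ d ≡ 1 → d ≡ 1 ⊎ d ≡ 3 →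
    ∀ L l → suc L ≡ 3 * l * m → ∀ {ρ ρ′} → ρ < m → ρ′ < m →
    ∑△ (suc L) (λ i j → ⟦ Φ a₁ a₂ i j %ℕ m ≟ ρ ⟧) ≡ ∑△ (suc L) (λ i j → ⟦ Φ a₁ a₂ i j %ℕ m ≟ ρ′ ⟧)
  Φ-balanced a₁ a₂ m m-odd a₂-scaled gcd≡1 d≡1⊎d≡3 L l 1+L≡3lm ρ<m ρ′<m =
    *-cancelˡ-≡ _ _ (3 * m) {{m*n≢0 3 m}} (*-cancelˡ-≡ _ _ (3 * m) {{m*n≢0 3 m}} (trans (average ρ<m) (sym (average ρ′<m))))
    where
    G : ℕ → ℕ → ℕ → ℕ
    G ρ i j = ⟦ Φ a₁ a₂ i j %ℕ m ≟ ρ ⟧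

    average : ∀ {ρ} → ρ < m → 3 * m * (3 * m * ∑△ (suc L) (G ρ)) ≡ ∑△ (suc L) (λ _ _ → 3 * m * 3)
    average {ρ} ρ<m = ∑△-average (G ρ) L (l * 3) rows columns antidiagonals (3 * m) 3 (λ a b → row-count a b 1 ρ<m)
      where
      open TriangleLines.Counts a₁ a₂ m m-odd a₂-scaled gcd≡1 d≡1⊎d≡3
      rows : ∀ a b → ∑ (suc L) (λ j → G ρ a (b + j)) ≡ l * 3
      rows a b = trans (cong (λ n → ∑ n (λ j → G ρ a (b + j))) 1+L≡3lm) (row-count a b l ρ<m)
      columns : ∀ a b → ∑ (suc L) (λ i → G ρ (a + i) b) ≡ l * 3
      columns a b = trans (cong (λ n → ∑ n (λ i → G ρ (a + i) b)) 1+L≡3lm) (column-count a b l ρ<m)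
      antidiagonals : ∀ a b → ∑ (suc L) (λ i → G ρ (a + i) (b + (L ∸ i))) ≡ l * 3
      antidiagonals a b = antidiagonal-count a b L l ρ<m 1+L≡3lm

open import Defs
open import Data.Nat using (ℕ; NonZero; _*_; _%_)
open import Data.Nat.GCD using (gcd)
open import Data.Integer using (ℤ; ∣_∣)
open import Data.Sum using (_⊎_)
open import Relation.Binary.PropositionalEquality using (_≡_)

open import Data.Nat using (suc; pred; _≟_)
open import Data.Nat.Properties using (suc-pred; m*n≢0)
open import Data.Integer.DivMod using (_%ℕ_)
open import Data.Fin using (toℕ)
open import Data.Fin.Properties using (toℕ<n)
open import Relation.Binary.PropositionalEquality using (refl; trans; sym; subst)
open FiniteSums using (∑△; ⟦_⟧)
open Units using (gcd⇒ScaledUnit)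
open ClosedForm using (Φ)
open Sequence using (mult≡∑△)
open Balance using (Φ-balanced)

theorem16 : (a₁ a₂ : ℤ) (m : ℕ) .{{_ : NonZero m}} →
    m % 2 ≡ 1 →
    gcd (∣ a₁ ∣) (gcd (∣ a₂ ∣) m) ≡ 1 →
    (gcd (∣ a₂ ∣) m ≡ 1 ⊎ gcd (∣ a₂ ∣) m ≡ 3) →
    (λ′ : ℕ) →
    Balanced m
      (IAP (πv m ((a₁ · A₁) ⊕ (a₂ · A₂))) (πv m ((a₁ · A₁) ⊕ (a₂ · A₂)) ⋆ X₂₄))
      (3 * λ′ * m)
theorem16 a₁ a₂ m m-odd gcd≡1 d≡1⊎d≡3 0       r s = refl
theorem16 a₁ a₂ m m-odd gcd≡1 d≡1⊎d≡3 (suc l) r s =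
  trans (mult≡∑△ a₁ a₂ m n r) (trans (subst (λ k → ∑△ k (G (toℕ r)) ≡ ∑△ k (G (toℕ s))) (suc-pred n) balanced) (sym (mult≡∑△ a₁ a₂ m n s)))
  where
  n : ℕ
  n = 3 * suc l * m
  instance
    n≢0 : NonZero n
    n≢0 = m*n≢0 (3 * suc l) m
  G : ℕ → ℕ → ℕ → ℕ
  G ρ i j = ⟦ Φ a₁ a₂ i j %ℕ m ≟ ρ ⟧
  balanced : ∑△ (suc (pred n)) (G (toℕ r)) ≡ ∑△ (suc (pred n)) (G (toℕ s))
  balanced = Φ-balanced a₁ a₂ m m-odd (gcd⇒ScaledUnit a₂ m) gcd≡1 d≡1⊎d≡3 (pred n) (suc l) (suc-pred n) (toℕ<n r) (toℕ<n s)
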